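{- Let $\Phi=(D,\varphi)$ be a $\mathbb{T}$-gain digraph on $n$ vertices. Then $$\det L(\Phi)=\sum_{\mathsf{E}\in\mathcal{E}(D)}(-1)^{c(\mathsf{E})}\varphi(\mathsf{E})\prod_{v\notin V(\mathsf{E})}\deg^{+}(v),$$ and $$\det Q(\Phi)=\sum_{\mathsf{E}\in\mathcal{E}(D)}(-1)^{|V(\mathsf{E})|+c(\mathsf{E})}\varphi(\mathsf{E})\prod_{v\notin V(\mathsf{E})}\deg^{+}(v),$$ where the summation is over all elementary subdigraphs of $D$.
   Context: A digraph $D=(V,\mathcal{A})$ has a finite vertex set $V=\{v_1,\dots,v_n\}$ and a set $\mathcal{A}$ of ordered pairs of distinct vertices, called arcs (no loops; at most one arc from $v_i$ to $v_j$ for each ordered pair; opposite arcs may both be present). The out-degree $\deg^+(v)$ is the number of arcs leaving $v$. A directed cycle is a closed directed walk whose vertices are distinct except that the first and last coincide (so its length is at least $2$; length $2$ is allowed). Let $\mathbb{T}=\{z\in\mathbb{C}:|z|=1\}$. A $\mathbb{T}$-gain digraph is a pair $\Phi=(D,\varphi)$ with $\varphi:\mathcal{A}\to\mathbb{T}$ an arbitrary function. Its gain adjacency matrix $A(\Phi)$ has entries $A(\Phi)_{ij}=\varphi(v_i,v_j)$ if $(v_i,v_j)\in\mathcal{A}$ and $0$ otherwise. With $D^+=\operatorname{diag}(\deg^+(v_1),\dots,\deg^+(v_n))$, set $L(\Phi)=D^+-A(\Phi)$ and $Q(\Phi)=D^++A(\Phi)$. An elementary subdigraph of $D$ is a subdigraph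 in which every vertex has in-degree and out-degree exactly $1$, equivalently a vertex-disjoint union of directed cycles of $D$. $\mathcal{E}(D)$ is the set of all elementary subdigraphs of $D$ covering any number of vertices, including the empty one $\mathsf{E}=\emptyset$ (for which $c(\mathsf{E})=0$, $V(\mathsf{E})=\emptyset$, $\varphi(\mathsf{E})=1$). $V(\mathsf{E})$ is the vertex set of $\mathsf{E}$, $c(\mathsf{E})$ the number of directed cycles composing it, and $\varphi(\mathsf{E})$ the product of the gains of these cycles, the gain of a directed cycle being the product of the gains of its arcs. -}

module Defs where

open import Algebra.Bundles using (CommutativeRing; Semiring)
import Algebra.Definitions.RawSemiring as RawSemiringDefinitions
open import Data.Fin.Base using (Fin; zero; suc; punchIn; toℕ)
import Data.Fin.Base as Fin
open import Data.Fin.Properties using (all?)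
import Data.Fin.Properties as Fin
open import Data.Fin.Subset using (Subset; _∈_; _∉_; inside; outside)
import Data.Fin.Subset as Subset
open import Data.Fin.Subset.Properties using (_∈?_)
open import Data.List.Base
  using (List; []; _∷_; _∷ʳ_; filter; foldr; length; concatMap; upTo; allFin;
         cartesianProductWith)
open import Data.List.Relation.Unary.All using (All)
import Data.List.Relation.Unary.All as All
open import Data.List.Relation.Unary.Linked using (Linked; linked?)
open import Data.List.Relation.Unary.Unique.Propositional using (Unique)
open import Data.List.Relation.Unary.Unique.DecPropositional using (unique?)
open import Data.Nat.Base using (ℕ)
import Data.Nat.Base as ℕ
import Data.Nat.Properties as ℕ
open import Data.Product.Base using (∃; _×_; _,_; proj₁; proj₂)
open import Data.Rational.Base using (ℚ; 0ℚ; 1ℚ; ½; Positive)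
import Data.Rational.Base as ℚ
import Data.Rational.Properties as ℚ
open import Data.Vec.Base using (Vec; []; _∷_; lookup; tabulate; toList)
open import Level using (0ℓ)
open import Relation.Binary.PropositionalEquality.Core
  using (_≡_; cong; subst; subst₂)
open import Relation.Nullary.Decidable using (Dec; yes; no; does; ¬?; _×-dec_; _→-dec_)

module RingIdentities {a ℓ} (R : CommutativeRing a ℓ) where

  open CommutativeRing R
  open import Algebra.Properties.Ring ring
    using (⁻¹-anti-homo‿-; -‿+-comm; -1*x≈-x; x[y-z]≈xy-xz; [y-z]x≈yx-zx)
  open import Algebra.Properties.CommutativeSemigroup +-commutativeSemigroup
    using (interchange; x∙yz≈y∙xz)
  open import Algebra.Solver.Ring.NaturalCoefficients.Default commutativeSemiring
    using (solve; con; _:+_; _:*_; _:=_)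
  open import Relation.Binary.Reasoning.Setoid setoid

  swap : ∀ p q → - (p - q) ≈ q - p
  swap = ⁻¹-anti-homo‿-

  difference-of-sums : ∀ p q r s → (p - q) + (r - s) ≈ (p + r) - (q + s)
  difference-of-sums p q r s =
    trans (interchange p (- q) r (- s)) (+-congˡ (-‿+-comm q s))

  telescope : ∀ p q r → (p - q) + (q - r) ≈ p - r
  telescope p q r = begin
    (p - q) + (q - r)    ≈⟨ +-assoc p (- q) (q - r) ⟩
    p + (- q + (q - r))  ≈⟨ +-congˡ (+-assoc (- q) q (- r)) ⟨
    p + ((- q + q) - r)  ≈⟨ +-congˡ (+-congʳ (-‿inverseˡ q)) ⟩
    p + (0# - r)         ≈⟨ +-congˡ (+-identityˡ (- r)) ⟩
    p - r                ∎

  cancel : ∀ p q → q + (p - q) ≈ p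
  cancel p q = begin
    q + (p - q)    ≈⟨ x∙yz≈y∙xz q p (- q) ⟩
    p + (q - q)    ≈⟨ +-congˡ (-‿inverseʳ q) ⟩
    p + 0#         ≈⟨ +-identityʳ p ⟩
    p              ∎

  neg-difference : ∀ p q → - (p - q) ≈ (- p) - (- q)
  neg-difference p q = sym (-‿+-comm p (- q))

  product-difference : ∀ p q r s → p * (r - s) + s * (p - q) ≈ p * r - q * s
  product-difference p q r s = begin
    p * (r - s) + s * (p - q)          ≈⟨ +-cong (x[y-z]≈xy-xz p r s) (*-comm s (p - q)) ⟩
    (p * r - p * s) + (p - q) * s      ≈⟨ +-congˡ ([y-z]x≈yx-zx s p q) ⟩
    (p * r - p * s) + (p * s - q * s)  ≈⟨ telescope (p * r) (p * s) (q * s) ⟩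
    p * r - q * s                      ∎

  -- The semiring solver knows no negation, so - 1# is passed to it as an indeterminate.
  private
    m : Carrier
    m = - 1#

    difference : ∀ x y → x - y ≈ x + m * y
    difference x y = +-congˡ (sym (-1*x≈-x y))

  complex-assoc-re : ∀ a b c d e f →
    (a * c - b * d) * e - (a * d + b * c) * f ≈ a * (c * e - d * f) - b * (c * f + d * e)
  complex-assoc-re a b c d e f = begin
    (a * c - b * d) * e - (a * d + b * c) * f
      ≈⟨ trans (difference _ _) (+-congʳ (*-congʳ (difference _ _))) ⟩
    (a * c + m * (b * d)) * e + m * ((a * d + b * c) * f)
      ≈⟨ solve 7 (λ a b c d e f m →
           (a :* c :+ m :* (b :* d)) :* e :+ m :* ((a :* d :+ b :* c) :* f)
           := a :* (c :* e :+ m :* (d :* f)) :+ m :* (b :* (c :* f :+ d :* e)))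
           refl a b c d e f m ⟩
    a * (c * e + m * (d * f)) + m * (b * (c * f + d * e))
      ≈⟨ trans (difference _ _) (+-congʳ (*-congˡ (difference _ _))) ⟨
    a * (c * e - d * f) - b * (c * f + d * e) ∎

  complex-assoc-im : ∀ a b c d e f →
    (a * c - b * d) * f + (a * d + b * c) * e ≈ a * (c * f + d * e) + b * (c * e - d * f)
  complex-assoc-im a b c d e f = begin
    (a * c - b * d) * f + (a * d + b * c) * e
      ≈⟨ +-congʳ (*-congʳ (difference _ _)) ⟩
    (a * c + m * (b * d)) * f + (a * d + b * c) * e
      ≈⟨ solve 7 (λ a b c d e f m →
           (a :* c :+ m :* (b :* d)) :* f :+ (a :* d :+ b :* c) :* e
           := a :* (c :* f :+ d :* e) :+ b :* (c :* e :+ m :* (d :* f)))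
           refl a b c d e f m ⟩
    a * (c * f + d * e) + b * (c * e + m * (d * f))
      ≈⟨ +-congˡ (*-congˡ (difference _ _)) ⟨
    a * (c * f + d * e) + b * (c * e - d * f) ∎

  complex-comm-re : ∀ a b c d → a * c - b * d ≈ c * a - d * b
  complex-comm-re a b c d = +-cong (*-comm a c) (-‿cong (*-comm b d))

  complex-comm-im : ∀ a b c d → a * d + b * c ≈ c * b + d * a
  complex-comm-im a b c d = trans (+-comm _ _) (+-cong (*-comm b c) (*-comm a d))

  complex-identity-re : ∀ a b → 1# * a - 0# * b ≈ a
  complex-identity-re a b = trans (difference _ _)
    (solve 3 (λ a b m → con 1 :* a :+ m :* (con 0 :* b) := a) refl a b m)

  complex-identity-im : ∀ a b → 1# * b + 0# * a ≈ b
  complex-identity-im = solve 2 (λ a b → con 1 :* b :+ con 0 :* a := b) refl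

  complex-distrib-re : ∀ a b c d e f →
    a * (c + e) - b * (d + f) ≈ (a * c - b * d) + (a * e - b * f)
  complex-distrib-re a b c d e f =
    trans (+-cong (distribˡ a c e) (-‿cong (distribˡ b d f)))
      (sym (difference-of-sums (a * c) (b * d) (a * e) (b * f)))

  complex-distrib-im : ∀ a b c d e f →
    a * (d + f) + b * (c + e) ≈ (a * d + b * c) + (a * f + b * e)
  complex-distrib-im a b c d e f =
    trans (+-cong (distribˡ a d f) (distribˡ b c e)) (interchange (a * d) (a * f) (b * c) (b * e))

module RationalSequences where

  open import Data.Rational.Base
  open RingIdentities ℚ.+-*-commutativeRing
  open import Relation.Binary.PropositionalEquality.Core using (refl; sym; trans)

  Eventually : (ℕ → Set) → Set
  Eventually P = ∃ λ N → ∀ n → N ℕ.≤ n → P n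

  Null : (ℕ → ℚ) → Set
  Null d = ∀ ε → 0ℚ < ε → Eventually λ n → ∣ d n ∣ < ε

  Cauchy : (ℕ → ℚ) → Set
  Cauchy s = ∀ ε → 0ℚ < ε → ∃ λ N → ∀ m n → N ℕ.≤ m → N ℕ.≤ n → ∣ s m - s n ∣ < ε

  private
    half-pos : ∀ ε → 0ℚ < ε → 0ℚ < ½ * ε
    half-pos ε p = subst (_< ½ * ε) (ℚ.*-zeroʳ ½) (ℚ.*-monoʳ-<-pos ½ p)

    halves : ∀ ε → ½ * ε + ½ * ε ≡ ε
    halves ε = trans (sym (ℚ.*-distribʳ-+ ε ½ ½)) (ℚ.*-identityˡ ε)

    split< : ∀ ε a b c → ∣ a ∣ < ½ * ε → ∣ b ∣ < ½ * ε → a + b ≡ c → ∣ c ∣ < ε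
    split< ε a b _ p q refl = subst (∣ a + b ∣ <_) (halves ε)
      (ℚ.≤-<-trans (ℚ.∣p+q∣≤∣p∣+∣q∣ a b) (ℚ.+-mono-< p q))

    ≤⊔ˡ : ∀ {M N n} → M ℕ.⊔ N ℕ.≤ n → M ℕ.≤ n
    ≤⊔ˡ {M} {N} = ℕ.≤-trans (ℕ.m≤m⊔n M N)

    ≤⊔ʳ : ∀ {M N n} → M ℕ.⊔ N ℕ.≤ n → N ℕ.≤ n
    ≤⊔ʳ {M} {N} = ℕ.≤-trans (ℕ.m≤n⊔m M N)

  zero-null : ∀ d → (∀ n → d n ≡ 0ℚ) → Null d
  zero-null d d≡0 ε 0<ε = 0 , λ n _ → subst (λ q → ∣ q ∣ < ε) (sym (d≡0 n)) 0<ε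

  null-cong : ∀ d e → (∀ n → d n ≡ e n) → Null d → Null e
  null-cong d e eq p ε 0<ε = let N , h = p ε 0<ε in
    N , λ n N≤n → subst (λ q → ∣ q ∣ < ε) (eq n) (h n N≤n)

  neg-null : ∀ d → Null d → Null (λ n → - d n)
  neg-null d p ε 0<ε = let N , h = p ε 0<ε in
    N , λ n N≤n → subst (_< ε) (sym (ℚ.∣-p∣≡∣p∣ (d n))) (h n N≤n)

  sum-null : ∀ d e → Null d → Null e → Null (λ n → d n + e n)
  sum-null d e p q ε 0<ε =
    let M , h = p (½ * ε) (half-pos ε 0<ε)
        N , k = q (½ * ε) (half-pos ε 0<ε)
    in M ℕ.⊔ N , λ n le → split< ε (d n) (e n) (d n + e n) (h n (≤⊔ˡ le)) (k n (≤⊔ʳ {M} le)) refl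

  Bounded : (ℕ → ℚ) → Set
  Bounded s = ∃ λ B → Positive B × Eventually λ n → ∣ s n ∣ ≤ B

  cauchy⇒bounded : ∀ s → Cauchy s → Bounded s
  cauchy⇒bounded s c =
    let N , h = c 1ℚ (ℚ.positive⁻¹ 1ℚ)
    in ∣ s N ∣ + 1ℚ
     , ℚ.nonNeg+pos⇒pos ∣ s N ∣ {{ℚ.∣-∣-nonNeg (s N)}} 1ℚ
     , N
     , λ n N≤n → subst (λ q → ∣ q ∣ ≤ ∣ s N ∣ + 1ℚ) (cancel (s n) (s N))
         (ℚ.≤-trans (ℚ.∣p+q∣≤∣p∣+∣q∣ (s N) (s n - s N))
           (ℚ.+-monoʳ-≤ ∣ s N ∣ (ℚ.<⇒≤ (h n N N≤n ℕ.≤-refl))))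

  module _ (B : ℚ) (B>0 : Positive B) where
    private
      instance
        B-positive : Positive B
        B-positive = B>0
        B-nonNeg : NonNegative B
        B-nonNeg = ℚ.pos⇒nonNeg B
        B-nonZero : NonZero B
        B-nonZero = ℚ.pos⇒nonZero B
        1/B-positive : Positive (1/ B)
        1/B-positive = ℚ.1/pos⇒pos B

    shrink : ℚ → ℚ
    shrink ε = (1/ B) * ε

    shrink-pos : ∀ ε → 0ℚ < ε → 0ℚ < shrink ε
    shrink-pos ε p = subst (_< shrink ε) (ℚ.*-zeroʳ (1/ B)) (ℚ.*-monoʳ-<-pos (1/ B) p)

    shrink-bound : ∀ ε a b → ∣ a ∣ ≤ B → ∣ b ∣ < shrink ε → ∣ a * b ∣ < ε
    shrink-bound ε a b a≤B b<δ =
      subst₂ _<_ (sym (ℚ.∣p*q∣≡∣p∣*∣q∣ a b))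
        (trans (sym (ℚ.*-assoc B (1/ B) ε))
          (trans (cong (_* ε) (ℚ.*-inverseʳ B)) (ℚ.*-identityˡ ε)))
        (ℚ.≤-<-trans (ℚ.*-monoʳ-≤-nonNeg ∣ b ∣ {{ℚ.∣-∣-nonNeg b}} a≤B)
          (ℚ.*-monoʳ-<-pos B b<δ))

  bounded*null : ∀ s d → Bounded s → Null d → Null (λ n → s n * d n)
  bounded*null s d (B , B>0 , M , h) p ε 0<ε =
    let N , k = p (shrink B B>0 ε) (shrink-pos B B>0 ε 0<ε)
    in M ℕ.⊔ N , λ n le → shrink-bound B B>0 ε (s n) (d n) (h n (≤⊔ˡ le)) (k n (≤⊔ʳ {M} le))

  const-cauchy : ∀ q → Cauchy (λ _ → q)
  const-cauchy q ε 0<ε =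
    0 , λ _ _ _ _ → subst (λ r → ∣ r ∣ < ε) (sym (ℚ.+-inverseʳ q)) 0<ε

  neg-cauchy : ∀ s → Cauchy s → Cauchy (λ n → - s n)
  neg-cauchy s c ε 0<ε = let N , h = c ε 0<ε in
    N , λ m n N≤m N≤n →
      subst (_< ε) (trans (sym (ℚ.∣-p∣≡∣p∣ (s m - s n))) (cong ∣_∣ (neg-difference (s m) (s n))))
        (h m n N≤m N≤n)

  +-cauchy : ∀ s t → Cauchy s → Cauchy t → Cauchy (λ n → s n + t n)
  +-cauchy s t c d ε 0<ε =
    let M , h = c (½ * ε) (half-pos ε 0<ε)
        N , k = d (½ * ε) (half-pos ε 0<ε)
    in M ℕ.⊔ N , λ m n le le′ →
      split< ε (s m - s n) (t m - t n) ((s m + t m) - (s n + t n))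
        (h m n (≤⊔ˡ le) (≤⊔ˡ le′)) (k m n (≤⊔ʳ {M} le) (≤⊔ʳ {M} le′))
        (difference-of-sums (s m) (s n) (t m) (t n))

  *-cauchy : ∀ s t → Cauchy s → Cauchy t → Cauchy (λ n → s n * t n)
  *-cauchy s t c d ε 0<ε =
    let B , B>0 , M , b  = cauchy⇒bounded s c
        C , C>0 , N , b′ = cauchy⇒bounded t d
        K , k = d (shrink B B>0 (½ * ε)) (shrink-pos B B>0 (½ * ε) (half-pos ε 0<ε))
        L , l = c (shrink C C>0 (½ * ε)) (shrink-pos C C>0 (½ * ε) (half-pos ε 0<ε))
    in (M ℕ.⊔ N) ℕ.⊔ (K ℕ.⊔ L) , λ m n le le′ →
      split< ε (s m * (t m - t n)) (t n * (s m - s n)) (s m * t m - s n * t n)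
        (shrink-bound B B>0 (½ * ε) (s m) (t m - t n) (b m (≤⊔ˡ (≤⊔ˡ le)))
          (k m n (≤⊔ˡ (≤⊔ʳ {M ℕ.⊔ N} le)) (≤⊔ˡ (≤⊔ʳ {M ℕ.⊔ N} le′))))
        (shrink-bound C C>0 (½ * ε) (t n) (s m - s n) (b′ n (≤⊔ʳ {M} (≤⊔ˡ le′)))
          (l m n (≤⊔ʳ {K} (≤⊔ʳ {M ℕ.⊔ N} le)) (≤⊔ʳ {K} (≤⊔ʳ {M ℕ.⊔ N} le′))))
        (product-difference (s m) (s n) (t m) (t n))

open RationalSequences using (Cauchy)

record ℝ : Set where
  no-eta-equality
  constructor real
  field
    seq    : ℕ → ℚ
    cauchy : Cauchy seq

open ℝ

module Real where

  open RationalSequences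
  open RingIdentities ℚ.+-*-commutativeRing
    using (swap; telescope; difference-of-sums; product-difference; neg-difference)
  open import Relation.Binary.PropositionalEquality
    using (refl; sym; trans; cong₂; module ≡-Reasoning)
  open ≡-Reasoning

  infix  4 _≈_ _≤_
  infixl 6 _+_
  infixl 7 _*_
  infix  8 -_

  -- Wrapped in a record so that x and y can be inferred from x ≈ y.
  record _≈_ (x y : ℝ) : Set where
    constructor mk≈
    field difference-null : Null (λ n → seq x n ℚ.- seq y n)

  open _≈_

  _≤_ : ℝ → ℝ → Set
  x ≤ y = ∀ ε → 0ℚ ℚ.< ε → Eventually λ n → seq x n ℚ.< seq y n ℚ.+ ε

  fromℚ : ℚ → ℝ
  fromℚ q = real (λ _ → q) (const-cauchy q)

  0# 1# : ℝ
  0# = fromℚ 0ℚ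
  1# = fromℚ 1ℚ

  -- The rational operations unfold even on variables, which makes comparing terms built
  -- from them very expensive; hence the opacity.
  opaque
    -_ : ℝ → ℝ
    - x = real (λ n → ℚ.- seq x n) (neg-cauchy (seq x) (cauchy x))

    _+_ _*_ : ℝ → ℝ → ℝ
    x + y = real (λ n → seq x n ℚ.+ seq y n) (+-cauchy (seq x) (seq y) (cauchy x) (cauchy y))
    x * y = real (λ n → seq x n ℚ.* seq y n) (*-cauchy (seq x) (seq y) (cauchy x) (cauchy y))

    seq-neg : ∀ x n → seq (- x) n ≡ ℚ.- seq x n
    seq-neg x n = refl

    seq-+ : ∀ x y n → seq (x + y) n ≡ seq x n ℚ.+ seq y n
    seq-+ x y n = refl

    seq-* : ∀ x y n → seq (x * y) n ≡ seq x n ℚ.* seq y n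
    seq-* x y n = refl

  pointwise : ∀ {x y} → (∀ n → seq x n ≡ seq y n) → x ≈ y
  pointwise {x} {y} eq .difference-null =
    zero-null (λ n → seq x n ℚ.- seq y n)
      λ n → trans (cong (ℚ._- seq y n) (eq n)) (ℚ.+-inverseʳ (seq y n))

  ≈-refl : ∀ {x} → x ≈ x
  ≈-refl {x} = pointwise {x} {x} λ _ → refl

  ≈-sym : ∀ {x y} → x ≈ y → y ≈ x
  ≈-sym {x} {y} (mk≈ p) .difference-null =
    null-cong (λ n → ℚ.- (seq x n ℚ.- seq y n)) (λ n → seq y n ℚ.- seq x n)
      (λ n → swap (seq x n) (seq y n))
      (neg-null (λ n → seq x n ℚ.- seq y n) p)

  ≈-trans : ∀ {x y z} → x ≈ y → y ≈ z → x ≈ z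
  ≈-trans {x} {y} {z} (mk≈ p) (mk≈ q) .difference-null =
    null-cong (λ n → (seq x n ℚ.- seq y n) ℚ.+ (seq y n ℚ.- seq z n)) (λ n → seq x n ℚ.- seq z n)
      (λ n → telescope (seq x n) (seq y n) (seq z n))
      (sum-null (λ n → seq x n ℚ.- seq y n) (λ n → seq y n ℚ.- seq z n) p q)

  +-cong : ∀ {x y u v} → x ≈ y → u ≈ v → (x + u) ≈ (y + v)
  +-cong {x} {y} {u} {v} (mk≈ p) (mk≈ q) .difference-null =
    null-cong (λ n → (seq x n ℚ.- seq y n) ℚ.+ (seq u n ℚ.- seq v n))
      (λ n → seq (x + u) n ℚ.- seq (y + v) n)
      (λ n → trans (difference-of-sums (seq x n) (seq y n) (seq u n) (seq v n))
        (sym (cong₂ ℚ._-_ (seq-+ x u n) (seq-+ y v n))))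
      (sum-null (λ n → seq x n ℚ.- seq y n) (λ n → seq u n ℚ.- seq v n) p q)

  *-cong : ∀ {x y u v} → x ≈ y → u ≈ v → (x * u) ≈ (y * v)
  *-cong {x} {y} {u} {v} (mk≈ p) (mk≈ q) .difference-null =
    null-cong
      (λ n → seq x n ℚ.* (seq u n ℚ.- seq v n) ℚ.+ seq v n ℚ.* (seq x n ℚ.- seq y n))
      (λ n → seq (x * u) n ℚ.- seq (y * v) n)
      (λ n → trans (product-difference (seq x n) (seq y n) (seq u n) (seq v n))
        (sym (cong₂ ℚ._-_ (seq-* x u n) (seq-* y v n))))
      (sum-null (λ n → seq x n ℚ.* (seq u n ℚ.- seq v n)) (λ n → seq v n ℚ.* (seq x n ℚ.- seq y n))
        (bounded*null (seq x) (λ n → seq u n ℚ.- seq v n) (cauchy⇒bounded (seq x) (cauchy x)) q)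
        (bounded*null (seq v) (λ n → seq x n ℚ.- seq y n) (cauchy⇒bounded (seq v) (cauchy v)) p))

  neg-cong : ∀ {x y} → x ≈ y → (- x) ≈ (- y)
  neg-cong {x} {y} (mk≈ p) .difference-null =
    null-cong (λ n → ℚ.- (seq x n ℚ.- seq y n)) (λ n → seq (- x) n ℚ.- seq (- y) n)
      (λ n → trans (neg-difference (seq x n) (seq y n))
        (sym (cong₂ ℚ._-_ (seq-neg x n) (seq-neg y n))))
      (neg-null (λ n → seq x n ℚ.- seq y n) p)

  +-assoc : ∀ x y z → ((x + y) + z) ≈ (x + (y + z))
  +-assoc x y z = pointwise λ n → begin
    seq ((x + y) + z) n                    ≡⟨ seq-+ (x + y) z n ⟩
    seq (x + y) n ℚ.+ seq z n              ≡⟨ cong (ℚ._+ seq z n) (seq-+ x y n) ⟩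
    (seq x n ℚ.+ seq y n) ℚ.+ seq z n      ≡⟨ ℚ.+-assoc (seq x n) (seq y n) (seq z n) ⟩
    seq x n ℚ.+ (seq y n ℚ.+ seq z n)      ≡⟨ cong (seq x n ℚ.+_) (seq-+ y z n) ⟨
    seq x n ℚ.+ seq (y + z) n              ≡⟨ seq-+ x (y + z) n ⟨
    seq (x + (y + z)) n                    ∎

  +-comm : ∀ x y → (x + y) ≈ (y + x)
  +-comm x y = pointwise λ n → begin
    seq (x + y) n          ≡⟨ seq-+ x y n ⟩
    seq x n ℚ.+ seq y n    ≡⟨ ℚ.+-comm (seq x n) (seq y n) ⟩
    seq y n ℚ.+ seq x n    ≡⟨ seq-+ y x n ⟨
    seq (y + x) n          ∎

  +-identityˡ : ∀ x → (0# + x) ≈ x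
  +-identityˡ x = pointwise λ n → trans (seq-+ 0# x n) (ℚ.+-identityˡ (seq x n))

  +-inverseˡ : ∀ x → ((- x) + x) ≈ 0#
  +-inverseˡ x = pointwise λ n → begin
    seq ((- x) + x) n            ≡⟨ seq-+ (- x) x n ⟩
    seq (- x) n ℚ.+ seq x n      ≡⟨ cong (ℚ._+ seq x n) (seq-neg x n) ⟩
    (ℚ.- seq x n) ℚ.+ seq x n    ≡⟨ ℚ.+-inverseˡ (seq x n) ⟩
    0ℚ                           ∎

  *-assoc : ∀ x y z → ((x * y) * z) ≈ (x * (y * z))
  *-assoc x y z = pointwise λ n → begin
    seq ((x * y) * z) n                    ≡⟨ seq-* (x * y) z n ⟩
    seq (x * y) n ℚ.* seq z n              ≡⟨ cong (ℚ._* seq z n) (seq-* x y n) ⟩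
    (seq x n ℚ.* seq y n) ℚ.* seq z n      ≡⟨ ℚ.*-assoc (seq x n) (seq y n) (seq z n) ⟩
    seq x n ℚ.* (seq y n ℚ.* seq z n)      ≡⟨ cong (seq x n ℚ.*_) (seq-* y z n) ⟨
    seq x n ℚ.* seq (y * z) n              ≡⟨ seq-* x (y * z) n ⟨
    seq (x * (y * z)) n                    ∎

  *-comm : ∀ x y → (x * y) ≈ (y * x)
  *-comm x y = pointwise λ n → begin
    seq (x * y) n          ≡⟨ seq-* x y n ⟩
    seq x n ℚ.* seq y n    ≡⟨ ℚ.*-comm (seq x n) (seq y n) ⟩
    seq y n ℚ.* seq x n    ≡⟨ seq-* y x n ⟨
    seq (y * x) n          ∎

  *-identityˡ : ∀ x → (1# * x) ≈ x
  *-identityˡ x = pointwise λ n → trans (seq-* 1# x n) (ℚ.*-identityˡ (seq x n))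

  distribˡ : ∀ x y z → (x * (y + z)) ≈ (x * y + x * z)
  distribˡ x y z = pointwise λ n → begin
    seq (x * (y + z)) n                              ≡⟨ seq-* x (y + z) n ⟩
    seq x n ℚ.* seq (y + z) n                        ≡⟨ cong (seq x n ℚ.*_) (seq-+ y z n) ⟩
    seq x n ℚ.* (seq y n ℚ.+ seq z n)                ≡⟨ ℚ.*-distribˡ-+ (seq x n) (seq y n) (seq z n) ⟩
    seq x n ℚ.* seq y n ℚ.+ seq x n ℚ.* seq z n
      ≡⟨ cong₂ ℚ._+_ (seq-* x y n) (seq-* x z n) ⟨
    seq (x * y) n ℚ.+ seq (x * z) n                  ≡⟨ seq-+ (x * y) (x * z) n ⟨
    seq (x * y + x * z) n                            ∎

  commutativeRing : CommutativeRing 0ℓ 0ℓ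
  commutativeRing = record
    { Carrier = ℝ ; _≈_ = _≈_ ; _+_ = _+_ ; _*_ = _*_ ; -_ = -_ ; 0# = 0# ; 1# = 1#
    ; isCommutativeRing = record
      { isRing = record
        { +-isAbelianGroup = record
          { isGroup = record
            { isMonoid = record
              { isSemigroup = record
                { isMagma = record
                  { isEquivalence = record { refl = ≈-refl ; sym = ≈-sym ; trans = ≈-trans }
                  ; ∙-cong = +-cong
                  }
                ; assoc = +-assoc
                }
              ; identity = +-identityˡ , λ x → ≈-trans (+-comm x 0#) (+-identityˡ x)
              }
            ; inverse = +-inverseˡ , λ x → ≈-trans (+-comm x (- x)) (+-inverseˡ x)
            ; ⁻¹-cong = neg-cong
            }
          ; comm = +-comm
          }
        ; *-cong = *-cong
        ; *-assoc = *-assoc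
        ; *-identity = *-identityˡ , λ x → ≈-trans (*-comm x 1#) (*-identityˡ x)
        ; distrib = distribˡ , λ x y z →
            ≈-trans (*-comm (y + z) x)
              (≈-trans (distribˡ x y z) (+-cong (*-comm x y) (*-comm x z)))
        }
      ; *-comm = *-comm
      }
    }

module Complexification {a ℓ} (R : CommutativeRing a ℓ) where

  private
    module R = CommutativeRing R
    module I = RingIdentities R
  open R using () renaming (_≈_ to _≈ᵣ_; _+_ to _+ᵣ_; _*_ to _*ᵣ_; _-_ to _-ᵣ_; -_ to -ᵣ_)

  infix  4 _≈_
  infixl 6 _+_ _+i_
  infixl 7 _*_
  infix  8 -_

  record Complex : Set a where
    constructor _+i_
    field
      re im : R.Carrier

  open Complex public

  record _≈_ (z w : Complex) : Set ℓ where
    constructor mk≈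
    field
      re-≈ : re z ≈ᵣ re w
      im-≈ : im z ≈ᵣ im w

  0# 1# : Complex
  0# = R.0# +i R.0#
  1# = R.1# +i R.0#

  -_ : Complex → Complex
  - z = (-ᵣ re z) +i (-ᵣ im z)

  _+_ _*_ : Complex → Complex → Complex
  z + w = (re z +ᵣ re w) +i (im z +ᵣ im w)
  z * w = (re z *ᵣ re w -ᵣ im z *ᵣ im w) +i (re z *ᵣ im w +ᵣ im z *ᵣ re w)

  private
    ≈-trans : ∀ {z w v} → z ≈ w → w ≈ v → z ≈ v
    ≈-trans (mk≈ p q) (mk≈ p′ q′) = mk≈ (R.trans p p′) (R.trans q q′)

    +-cong : ∀ {z w u v} → z ≈ w → u ≈ v → (z + u) ≈ (w + v)
    +-cong (mk≈ p q) (mk≈ p′ q′) = mk≈ (R.+-cong p p′) (R.+-cong q q′)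

    *-comm : ∀ z w → (z * w) ≈ (w * z)
    *-comm z w =
      mk≈ (I.complex-comm-re (re z) (im z) (re w) (im w))
          (I.complex-comm-im (re z) (im z) (re w) (im w))

    *-identityˡ : ∀ z → (1# * z) ≈ z
    *-identityˡ z = mk≈ (I.complex-identity-re (re z) (im z)) (I.complex-identity-im (re z) (im z))

    distribˡ : ∀ z w v → (z * (w + v)) ≈ (z * w + z * v)
    distribˡ z w v =
      mk≈ (I.complex-distrib-re (re z) (im z) (re w) (im w) (re v) (im v))
          (I.complex-distrib-im (re z) (im z) (re w) (im w) (re v) (im v))

  commutativeRing : CommutativeRing a ℓ
  commutativeRing = record
    { Carrier = Complex ; _≈_ = _≈_ ; _+_ = _+_ ; _*_ = _*_ ; -_ = -_ ; 0# = 0# ; 1# = 1#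
    ; isCommutativeRing = record
      { isRing = record
        { +-isAbelianGroup = record
          { isGroup = record
            { isMonoid = record
              { isSemigroup = record
                { isMagma = record
                  { isEquivalence = record
                    { refl  = mk≈ R.refl R.refl
                    ; sym   = λ (mk≈ p q) → mk≈ (R.sym p) (R.sym q)
                    ; trans = ≈-trans
                    }
                  ; ∙-cong = +-cong
                  }
                ; assoc = λ z w v → mk≈ (R.+-assoc (re z) (re w) (re v)) (R.+-assoc (im z) (im w) (im v))
                }
              ; identity = (λ z → mk≈ (R.+-identityˡ (re z)) (R.+-identityˡ (im z)))
                         , (λ z → mk≈ (R.+-identityʳ (re z)) (R.+-identityʳ (im z)))
              }
            ; inverse = (λ z → mk≈ (R.-‿inverseˡ (re z)) (R.-‿inverseˡ (im z)))
                      , (λ z → mk≈ (R.-‿inverseʳ (re z)) (R.-‿inverseʳ (im z)))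
            ; ⁻¹-cong = λ (mk≈ p q) → mk≈ (R.-‿cong p) (R.-‿cong q)
            }
          ; comm = λ z w → mk≈ (R.+-comm (re z) (re w)) (R.+-comm (im z) (im w))
          }
        ; *-cong = λ (mk≈ p q) (mk≈ p′ q′) →
            mk≈ (R.+-cong (R.*-cong p p′) (R.-‿cong (R.*-cong q q′)))
                (R.+-cong (R.*-cong p q′) (R.*-cong q p′))
        ; *-assoc = λ z w v →
            mk≈ (I.complex-assoc-re (re z) (im z) (re w) (im w) (re v) (im v))
                (I.complex-assoc-im (re z) (im z) (re w) (im w) (re v) (im v))
        ; *-identity = *-identityˡ , λ z → ≈-trans (*-comm z 1#) (*-identityˡ z)
        ; distrib = distribˡ , λ z w v →
            ≈-trans (*-comm (w + v) z)
              (≈-trans (distribˡ z w v) (+-cong (*-comm z w) (*-comm z v)))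
        }
      ; *-comm = *-comm
      }
    }

module ℂ = Complexification Real.commutativeRing

ℂ : Set
ℂ = ℂ.Complex

-- |z| is the non-negative square root of re² + im²; no square-root function is needed.
HasModulus : ℂ → ℝ → Set
HasModulus z r = Real.0# Real.≤ r × (r Real.* r) Real.≈ (re z Real.* re z Real.+ im z Real.* im z)
  where open ℂ

𝕋 : Set
𝕋 = ∃ λ z → HasModulus z Real.1#

words : {A : Set} → List A → ∀ n → List (Vec A n)
words xs ℕ.zero    = [] ∷ []
words xs (ℕ.suc n) = cartesianProductWith _∷_ xs (words xs n)

-- The i-th entry is the set of out-neighbours of i.
ArcSet : ℕ → Set
ArcSet n = Vec (Subset n) n

infix 4 _⟶[_]_ _⟶[_]?_

_⟶[_]_ : ∀ {n} → Fin n → ArcSet n → Fin n → Set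
u ⟶[ 𝒜 ] v = v ∈ lookup 𝒜 u

_⟶[_]?_ : ∀ {n} (u : Fin n) (𝒜 : ArcSet n) (v : Fin n) → Dec (u ⟶[ 𝒜 ] v)
u ⟶[ 𝒜 ]? v = v ∈? lookup 𝒜 u

outDegree inDegree : ∀ {n} → ArcSet n → Fin n → ℕ
outDegree 𝒜 v = Subset.∣ lookup 𝒜 v ∣
inDegree  𝒜 v = Subset.∣ tabulate (λ u → does (u ⟶[ 𝒜 ]? v)) ∣

record Digraph (n : ℕ) : Set where
  field
    arcs     : ArcSet n
    loopless : ∀ v → v ∉ lookup arcs v

  deg⁺ : Fin n → ℕ
  deg⁺ = outDegree arcs

-- The directed cycle v₀ → v₁ → ⋯ → vₖ → v₀ is represented by v₀ and the list v₁ ∷ ⋯ ∷ vₖ.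
-- Requiring v₀ to be the least vertex picks one of the k + 1 rotations, so that each
-- cycle, as a digraph, has exactly one representation.  In a loopless digraph k ≥ 1.
record Cycle (n : ℕ) : Set where
  constructor cycle
  field
    base : Fin n
    rest : List (Fin n)

  vertices : List (Fin n)
  vertices = base ∷ rest

  closedWalk : List (Fin n)
  closedWalk = base ∷ (rest ∷ʳ base)

IsDirectedCycle : ∀ {n} → ArcSet n → Cycle n → Set
IsDirectedCycle 𝒜 C =
  Linked _⟶[ 𝒜 ]_ closedWalk × Unique vertices × All (base Fin.<_) rest
  where open Cycle C

isDirectedCycle? : ∀ {n} (𝒜 : ArcSet n) (C : Cycle n) → Dec (IsDirectedCycle 𝒜 C)
isDirectedCycle? 𝒜 C =
  linked? _⟶[ 𝒜 ]?_ closedWalk ×-dec unique? Fin._≟_ vertices ×-dec All.all? (base Fin.<?_) rest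
  where open Cycle C

-- The vertices of a directed cycle are distinct, so k + 1 ≤ n in the notation above.
candidateCycles : ∀ n → List (Cycle n)
candidateCycles n = concatMap
  (λ k → cartesianProductWith (λ v vs → cycle v (toList vs)) (allFin n) (words (allFin n) k))
  (upTo n)

directedCycles : ∀ {n} → ArcSet n → List (Cycle n)
directedCycles {n} 𝒜 = filter (isDirectedCycle? 𝒜) (candidateCycles n)

record Subdigraph (n : ℕ) : Set where
  constructor subdigraph
  field
    V    : Subset n
    arcs : ArcSet n

  c : ℕ
  c = length (directedCycles arcs)

  uncovered : List (Fin n)
  uncovered = filter (λ v → ¬? (v ∈? V)) (allFin n)

subdigraphs : ∀ n → List (Subdigraph n)
subdigraphs n = cartesianProductWith subdigraph subsets (words subsets n)
  where subsets = words (outside ∷ inside ∷ []) n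

module _ {n} (D : Digraph n) where
  open Subdigraph using (V; arcs)
  private module D = Digraph D

  IsSubdigraph : Subdigraph n → Set
  IsSubdigraph H = ∀ u v → u ⟶[ arcs H ] v → u ⟶[ D.arcs ] v × u ∈ V H × v ∈ V H

  IsElementary : Subdigraph n → Set
  IsElementary H =
    IsSubdigraph H × (∀ v → v ∈ V H → inDegree (arcs H) v ≡ 1 × outDegree (arcs H) v ≡ 1)

  isElementary? : ∀ H → Dec (IsElementary H)
  isElementary? H =
    (all? λ u → all? λ v →
      (u ⟶[ arcs H ]? v) →-dec (u ⟶[ D.arcs ]? v) ×-dec (u ∈? V H) ×-dec (v ∈? V H))
    ×-dec
    (all? λ v → (v ∈? V H) →-dec
      (inDegree (arcs H) v ℕ.≟ 1) ×-dec (outDegree (arcs H) v ℕ.≟ 1))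

  𝓔 : List (Subdigraph n)
  𝓔 = filter isElementary? (subdigraphs n)

module LinearAlgebra {c ℓ} (R : CommutativeRing c ℓ) where

  open CommutativeRing R hiding (zero)
  open RawSemiringDefinitions (Semiring.rawSemiring semiring) using (sum; _^_)

  Matrix : ℕ → Set c
  Matrix n = Fin n → Fin n → Carrier

  -- Laplace expansion along the first row.
  det : ∀ {n} → Matrix n → Carrier
  det {ℕ.zero}  M = 1#
  det {ℕ.suc n} M =
    sum λ j → (- 1#) ^ toℕ j * M zero j * det (λ i k → M (suc i) (punchIn j k))

  diag : ∀ {n} → (Fin n → Carrier) → Matrix n
  diag d i j with i Fin.≟ j
  ... | yes _ = d i
  ... | no  _ = 0#

  infixl 6 _⊞_ _⊟_

  _⊞_ _⊟_ : ∀ {n} → Matrix n → Matrix n → Matrix n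
  (M ⊞ N) i j = M i j + N i j
  (M ⊟ N) i j = M i j - N i j

  ∑ ∏ : {A : Set} → List A → (A → Carrier) → Carrier
  ∑ xs f = foldr (λ x s → f x + s) 0# xs
  ∏ xs f = foldr (λ x p → f x * p) 1# xs

  infix 5 ∑ ∏
  syntax ∑ xs (λ x → e) = ∑[ x ← xs ] e
  syntax ∏ xs (λ x → e) = ∏[ x ← xs ] e

open LinearAlgebra ℂ.commutativeRing public
open CommutativeRing ℂ.commutativeRing public
  using () renaming (_≈_ to _≈ᶜ_; _*_ to _*ᶜ_; -_ to -ᶜ_; 0# to 0ᶜ; 1# to 1ᶜ)
open RawSemiringDefinitions
  (Semiring.rawSemiring (CommutativeRing.semiring ℂ.commutativeRing)) public
  using () renaming (_×_ to _×ᶜ_; _^_ to _^ᶜ_)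

record 𝕋GainDigraph (n : ℕ) : Set where
  field
    digraph : Digraph n

  open Digraph digraph public

  field
    φ : ∀ u v → u ⟶[ arcs ] v → 𝕋

  A : Matrix n
  A u v with u ⟶[ arcs ]? v
  ... | yes uv = proj₁ (φ u v uv)
  ... | no  _  = 0ᶜ

  deg⁺ᶜ : Fin n → ℂ
  deg⁺ᶜ v = deg⁺ v ×ᶜ 1ᶜ

  D⁺ L Q : Matrix n
  D⁺ = diag deg⁺ᶜ
  L  = D⁺ ⊟ A
  Q  = D⁺ ⊞ A

  -- Only applied to walks in the digraph, along which A u v is the gain of the arc u ⟶ v.
  walkGain : List (Fin n) → ℂ
  walkGain (u ∷ v ∷ vs) = A u v *ᶜ walkGain (v ∷ vs)
  walkGain _            = 1ᶜ

  cycleGain : Cycle n → ℂ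
  cycleGain C = walkGain (Cycle.closedWalk C)

  φᴱ : Subdigraph n → ℂ
  φᴱ E = ∏[ C ← directedCycles (Subdigraph.arcs E) ] cycleGain C

open 𝕋GainDigraph public using (digraph; L; Q; φᴱ; deg⁺ᶜ)
open Subdigraph public using (V; c; uncovered)

{-# OPTIONS --safe #-}
module Submission where

open import Algebra.Bundles using (CommutativeMonoid; CommutativeRing)
open import Data.Bool.Base using (true; false; if_then_else_)
open import Data.Fin.Base using (Fin; zero; suc; toℕ; punchIn; _<_; _≤_)
open import Data.Fin.Properties using (_≟_; suc-injective; 0≢1+n; all?; ¬∀⟶∃¬)
import Data.Fin.Properties as Fin
open import Data.Fin.Subset using (Subset; Side; inside; outside; ∣_∣; ⁅_⁆)
  renaming (_∈_ to _∈ˢ_; _∉_ to _∉ˢ_)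
open import Data.Fin.Subset.Properties
  using (⊆-antisym; x∈⁅x⁆; x∈⁅y⁆⇒x≡y; ∣⁅x⁆∣≡1; _∈?_; x∈p⇒∣p-x∣<∣p∣)
open import Data.List.Base
  using (List; []; _∷_; _∷ʳ_; _++_; head; drop; foldr; map; concatMap; filter; length; upTo; allFin;
         cartesianProductWith)
open import Data.List.Properties
  using (map-tabulate; map-++; map-concatMap; concatMap-map; length-map; length-++; length-tabulate)
open import Data.List.Membership.Propositional using (_∈_; _∉_; find; lose)
open import Data.List.Membership.Propositional.Properties
  using (∈-∃++; ∈-allFin; ∈-upTo⁺; ∈-++⁺ʳ; ∈-map⁺; ∈-map⁻; ∈-filter⁺; ∈-filter⁻;
         ∈-concatMap⁺; ∈-concatMap⁻; ∈-cartesianProductWith⁺; ∈-cartesianProductWith⁻)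
open import Data.List.Membership.Propositional.Properties.WithK using (unique∧set⇒bag)
open import Data.List.Relation.Binary.BagAndSetEquality using (∼bag⇒↭)
open import Data.List.Relation.Binary.Permutation.Propositional
  using (_↭_; prep; swap; ↭-refl; ↭-sym; ↭-trans; ↭-reflexive; ↭⇒↭ₛ)
import Data.List.Relation.Binary.Permutation.Propositional as ↭
open import Data.List.Relation.Binary.Permutation.Propositional.Properties
  using (∈-resp-↭; ++⁺ˡ; ++⁺ʳ; ++-comm; shift; shifts; ↭-length; ↭-singleton-inv)
  renaming (map⁺ to ↭-map⁺)
import Data.List.Relation.Binary.Permutation.Setoid.Properties as ↭ₛ
open import Data.List.Relation.Unary.All using (All; []; _∷_)
import Data.List.Relation.Unary.All as All
import Data.List.Relation.Unary.All.Properties as All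
open import Data.List.Relation.Unary.AllPairs using ([]; _∷_)
import Data.List.Relation.Unary.AllPairs as AllPairs
import Data.List.Relation.Unary.AllPairs.Properties as AllPairs
open import Data.List.Relation.Unary.Any using (here; there)
import Data.List.Relation.Unary.Any as Any
open import Data.List.Relation.Unary.Linked using (Linked; [-]; _∷_)
open import Data.List.Relation.Unary.Unique.Propositional using (Unique)
open import Data.List.Relation.Unary.Unique.Propositional.Properties
  using (allFin⁺; upTo⁺; Unique[x∷xs]⇒x∉xs; filter⁺; map⁺; concat⁺; cartesianProductWith⁺)
open import Data.Nat.Base using (ℕ; zero; suc; _+_; z≤n; s≤s)
import Data.Nat.Base as ℕ
import Data.Nat.Properties as ℕ
open import Data.Product.Base using (∃; _×_; _,_; proj₁; proj₂)
open import Data.Unit.Base using (tt)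
open import Data.Vec.Base using (Vec; []; _∷_; here; there; lookup; tabulate; toList; fromList)
open import Data.Vec.Properties
  using (lookup∘tabulate; []=⇒lookup; lookup⇒[]=; tabulate-cong; tabulate∘lookup; ∷-injective;
         toList∘fromList; length-toList)
open import Function.Base using (_∘_; id)
open import Function.Bundles using (mk⇔)
open import Function.Definitions using (Injective)
open import Relation.Binary.PropositionalEquality as ≡
  using (_≡_; _≢_; _≗_; refl; cong; cong₂; sym; trans; subst)
open import Relation.Nullary using (¬_; Dec; yes; no; does; contradiction; _×-dec_; ¬?)
open import Relation.Nullary.Decidable using (dec-true; _→-dec_)
open import Relation.Unary using (Pred; Decidable; U)

open import Defs hiding (det; Matrix; ∑; ∏; diag; _⊞_; _⊟_; V; c)
open Cycle

-- Peeling vertices off one at a time expands the determinant over permutations: in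
-- det M = Σ_w ± M 0 w · det(M with row 0 deleted and column w replaced by column 0), the sign being
-- + only for w = 0, the matrix on the right has the entries of the permutation obtained by
-- contracting 0 out of its cycle.  Contracting a fixed point removes a vertex and a cycle,
-- contracting any other point removes a vertex only, so the sign of a permutation of n points with k
-- cycles is (-1)^(n + k).  Forgetting fixed points turns permutations along arcs of D into
-- elementary subdigraphs: the fixed points pick up the out-degrees, the remaining cycles the gain.

-- The determinant is defined by recursive Laplace expansion, whereas `𝓔` filters all pairs of a
-- vertex set and an arc set, and the cycles of each member come from a second search; the two sides
-- share no recursion. `Code` mediates between them. Its constructor is exactly one step of the
-- expansion, so signs and cycles of permutations are obtained by structural recursion on codes. The
-- searched lists are compared with lists built from codes only up to reordering: both are free of
-- duplicates and have the same members. Contracting the vertex 0, rather than any other, fits the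
-- representation of cycles: undoing the step puts 0 at the front of its cycle, so every cycle is
-- automatically based at its least vertex. Both matrices are treated at once, with off-diagonal
-- entries `e * A u v` for `e` equal to `- 1#` or `1#`. The sign of the permutation supplies
-- (-1)^(|V| + c) in either case, and the factor e^|V| accounts for the difference between the two
-- formulas.

-- Finite sums and products over lists

module FoldProperties {c ℓ} (M : CommutativeMonoid c ℓ) where

  open CommutativeMonoid M renaming (refl to ≈-refl; sym to ≈-sym; trans to ≈-trans)
  open import Algebra.Properties.CommutativeSemigroup commutativeSemigroup
    using (interchange; x∙yz≈y∙xz)

  private
    variable
      A B : Set
      f g : A → Carrier

  fold : List A → (A → Carrier) → Carrier
  fold xs f = foldr (λ x s → f x ∙ s) ε xs

  fold-cong : ∀ xs → (∀ {x} → x ∈ xs → f x ≈ g x) → fold xs f ≈ fold xs g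
  fold-cong []       eq = ≈-refl
  fold-cong (x ∷ xs) eq = ∙-cong (eq (here refl)) (fold-cong xs (eq ∘ there))

  fold-map : (h : A → B) (xs : List A) → fold (map h xs) f ≡ fold xs (f ∘ h)
  fold-map h []       = refl
  fold-map {f = f} h (x ∷ xs) = cong (f (h x) ∙_) (fold-map h xs)

  fold-++ : ∀ xs ys → fold (xs ++ ys) f ≈ fold xs f ∙ fold ys f
  fold-++ []       ys = ≈-sym (identityˡ _)
  fold-++ (x ∷ xs) ys = ≈-trans (∙-congˡ (fold-++ xs ys)) (≈-sym (assoc _ _ _))

  fold-concatMap : (h : A → List B) (xs : List A) →
                   fold (concatMap h xs) f ≈ fold xs (λ x → fold (h x) f)
  fold-concatMap h []       = ≈-refl
  fold-concatMap h (x ∷ xs) = ≈-trans (fold-++ (h x) _) (∙-congˡ (fold-concatMap h xs))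

  fold-∙ : (xs : List A) → fold xs (λ x → f x ∙ g x) ≈ fold xs f ∙ fold xs g
  fold-∙ []       = ≈-sym (identityˡ ε)
  fold-∙ (x ∷ xs) = ≈-trans (∙-congˡ (fold-∙ xs)) (interchange _ _ _ _)

  fold-↭ : ∀ {xs ys} → xs ↭ ys → fold xs f ≈ fold ys f
  fold-↭ ↭.refl        = ≈-refl
  fold-↭ (prep x p)    = ∙-congˡ (fold-↭ p)
  fold-↭ (swap x y p)  = ≈-trans (x∙yz≈y∙xz _ _ _) (∙-congˡ (∙-congˡ (fold-↭ p)))
  fold-↭ (↭.trans p q) = ≈-trans (fold-↭ p) (fold-↭ q)

  -- Extension by the neutral element, so that products over different sets of vertices can all be
  -- taken over the whole vertex list and split factor by factor.
  restrict : ∀ {p} {P : Pred A p} → Decidable P → (A → Carrier) → A → Carrier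
  restrict P? f x = if does (P? x) then f x else ε

  module _ {p} {P : Pred A p} (P? : Decidable P) where

    restrict-∈ : ∀ f x → P x → restrict P? f x ≈ f x
    restrict-∈ f x px with P? x
    ... | yes _  = ≈-refl
    ... | no ¬px = contradiction px ¬px

    restrict-∉ : ∀ f x → ¬ P x → restrict P? f x ≈ ε
    restrict-∉ f x ¬px with P? x
    ... | yes px = contradiction px ¬px
    ... | no  _  = ≈-refl

    fold-filter : ∀ xs → fold (filter P? xs) f ≈ fold xs (restrict P? f)
    fold-filter []       = ≈-refl
    fold-filter (x ∷ xs) with P? x
    ... | yes _ = ∙-congˡ (fold-filter xs)
    ... | no  _ = ≈-trans (fold-filter xs) (≈-sym (identityˡ _))

  fold-cartesianProductWith : ∀ {C : Set} {f : C → Carrier} (h : A → B → C) xs ys →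
    fold (cartesianProductWith h xs ys) f ≈ fold xs (λ x → fold ys (f ∘ h x))
  fold-cartesianProductWith h []       ys = ≈-refl
  fold-cartesianProductWith h (x ∷ xs) ys =
    ≈-trans (fold-++ (map (h x) ys) _)
      (∙-cong (reflexive (fold-map (h x) ys)) (fold-cartesianProductWith h xs ys))

  fold-allFin : ∀ {n} (f : Fin (suc n) → Carrier) →
                fold (allFin (suc n)) f ≡ f zero ∙ fold (allFin n) (f ∘ suc)
  fold-allFin {n} f = cong (f zero ∙_)
    (trans (cong (λ xs → fold xs f) (sym (map-tabulate id suc))) (fold-map suc (allFin n)))

-- Permutation codes and index bookkeeping

-- Codes a permutation σ by σ 0 and the code of the permutation obtained from σ by deleting 0
-- from its cycle.
infixr 5 _∷_

data Code : ℕ → Set where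
  []  : Code 0
  _∷_ : ∀ {n} → Fin (suc n) → Code n → Code (suc n)

-- Undoes the contraction at 0: the point that the contracted permutation sends to `v` goes to 0
-- again. Read as column indices, `redirect (suc v)` lists all columns but `suc v`, with column 0
-- standing in for it.
redirect : ∀ {n} → Fin (suc n) → Fin n → Fin (suc n)
redirect zero    j = suc j
redirect (suc v) j = if does (j ≟ v) then zero else suc j

decode : ∀ {n} → Code n → Fin n → Fin n
decode (w ∷ κ) zero    = w
decode (w ∷ κ) (suc i) = redirect w (decode κ i)

codes : ∀ n → List (Code n)
codes zero    = [] ∷ []
codes (suc n) = cartesianProductWith _∷_ (allFin (suc n)) (codes n)

-- The index of v once the index punchIn v k has been removed.
skip : ∀ {m} → Fin (suc m) → Fin m → Fin m
skip {suc m} zero    k       = zero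
skip {suc m} (suc v) zero    = v
skip {suc m} (suc v) (suc k) = suc (skip v k)

punchIn-skip : ∀ {m} (v : Fin (suc m)) (k : Fin m) → punchIn (punchIn v k) (skip v k) ≡ v
punchIn-skip {suc m} zero    k       = refl
punchIn-skip {suc m} (suc v) zero    = refl
punchIn-skip {suc m} (suc v) (suc k) = cong suc (punchIn-skip v k)

-- Both sides list the columns left after deleting the same two, in the two possible orders.
punchIn-punchIn-skip : ∀ {m} (v : Fin (suc (suc m))) (k : Fin (suc m)) (l : Fin m) →
  punchIn (punchIn v k) (punchIn (skip v k) l) ≡ punchIn v (punchIn k l)
punchIn-punchIn-skip zero    k       l       = refl
punchIn-punchIn-skip (suc v) zero    l       = refl
punchIn-punchIn-skip (suc v) (suc k) zero    = refl
punchIn-punchIn-skip (suc v) (suc k) (suc l) = cong suc (punchIn-punchIn-skip v k l)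

redirect-≡ : ∀ {n} (v : Fin n) → redirect (suc v) v ≡ zero
redirect-≡ v with v ≟ v
... | yes _ = refl
... | no ¬p = contradiction refl ¬p

redirect-≢ : ∀ {n} {v j : Fin n} → j ≢ v → redirect (suc v) j ≡ suc j
redirect-≢ {v = v} {j} j≢v with j ≟ v
... | yes p = contradiction p j≢v
... | no  _ = refl

-- The determinant as a signed sum over codes

module Determinant {c ℓ} (R : CommutativeRing c ℓ) where

  open CommutativeRing R hiding (zero)
    renaming (refl to ≈-refl; sym to ≈-sym; trans to ≈-trans; _+_ to _⊕_)
  open LinearAlgebra R
  open import Algebra.Properties.Ring ring using (-1*x≈-x; -‿involutive)
  open import Algebra.Properties.Semiring.Exp semiring using (_^_; ^-homo-*)
  open import Algebra.Properties.CommutativeMonoid.Sum +-commutativeMonoid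
    using (sum; sum-cong-≋; sum-remove)
  open import Algebra.Properties.Semiring.Sum semiring using (*-distribˡ-sum)
  open import Algebra.Properties.CommutativeSemigroup *-commutativeSemigroup
    using (interchange; xy∙z≈xz∙y)
  open import Relation.Binary.Reasoning.Setoid setoid

  module Sum  = FoldProperties +-commutativeMonoid
  module Prod = FoldProperties *-commutativeMonoid

  -1^_ : ℕ → Carrier
  -1^ k = (- 1#) ^ k

  -1*-1* : ∀ x → - 1# * (- 1# * x) ≈ x
  -1*-1* x = ≈-trans (-1*x≈-x _) (≈-trans (-‿cong (-1*x≈-x x)) (-‿involutive x))

  det-cong : ∀ {n} {M N : Matrix n} → (∀ i j → M i j ≈ N i j) → det M ≈ det N
  det-cong {zero}  eq = ≈-refl
  det-cong {suc n} eq = sum-cong-≋ λ j →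
    *-cong (*-congˡ {x = -1^ (toℕ j)} (eq zero j)) (det-cong λ i k → eq (suc i) (punchIn j k))

  private
    -- If `k` lies before `v`, the exponents on the left are k and v - 1; otherwise they are k + 1
    -- and v. Either sum has the parity of v + k + 1.
    sign-skip : ∀ {m} (v : Fin (suc m)) (k : Fin m) →
                -1^ (toℕ (punchIn v k)) * -1^ (toℕ (skip v k)) ≈ -1^ (toℕ v) * -1^ (suc (toℕ k))
    sign-skip {suc m} zero    k       = *-comm _ _
    sign-skip {suc m} (suc v) zero    = begin
      1# * -1^ toℕ v                      ≈⟨ *-identityˡ _ ⟩
      -1^ toℕ v                           ≈⟨ -1*-1* _ ⟨
      - 1# * (- 1# * -1^ toℕ v)           ≈⟨ *-congˡ (*-comm _ _) ⟩
      - 1# * (-1^ toℕ v * - 1#)           ≈⟨ *-assoc _ _ _ ⟨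
      - 1# * -1^ toℕ v * - 1#             ≈⟨ *-congˡ (*-identityʳ _) ⟨
      - 1# * -1^ toℕ v * (- 1# * 1#)      ∎
    sign-skip {suc m} (suc v) (suc k) = begin
      (- 1# * -1^ toℕ (punchIn v k)) * (- 1# * -1^ toℕ (skip v k))  ≈⟨ interchange _ _ _ _ ⟩
      (- 1# * - 1#) * (-1^ toℕ (punchIn v k) * -1^ toℕ (skip v k))  ≈⟨ *-congˡ (sign-skip v k) ⟩
      (- 1# * - 1#) * (-1^ toℕ v * -1^ suc (toℕ k))                 ≈⟨ interchange _ _ _ _ ⟩
      (- 1# * -1^ toℕ v) * (- 1# * -1^ suc (toℕ k))                 ∎

  -- `N′` is `N` with column 0 moved to place `v`. In the first-row expansion the moved column
  -- leaves the same minor in both matrices; deleting any other column leaves minors that again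
  -- differ by moving column 0, now to `skip v k`, so induction on the size applies.
  det-move-column : ∀ {m} (v : Fin (suc m)) (N N′ : Matrix (suc m)) →
    (∀ i → N′ i v ≈ N i zero) → (∀ i k → N′ i (punchIn v k) ≈ N i (suc k)) →
    det N′ ≈ -1^ (toℕ v) * det N
  det-move-column {m} v N N′ eq₀ eq₊ = begin
    sum t′                                                 ≈⟨ sum-remove {i = v} t′ ⟩
    t′ v ⊕ sum (λ k → t′ (punchIn v k))
      ≈⟨ +-cong moved (sum-cong-≋ (shifted m v N N′ eq₀ eq₊)) ⟩
    -1^ (toℕ v) * t zero ⊕ sum (λ k → -1^ (toℕ v) * t (suc k))
      ≈⟨ +-congˡ (*-distribˡ-sum (-1^ (toℕ v)) (λ k → t (suc k))) ⟨
    -1^ (toℕ v) * t zero ⊕ -1^ (toℕ v) * sum (λ k → t (suc k)) ≈⟨ distribˡ _ _ _ ⟨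
    -1^ (toℕ v) * sum t                                    ∎
    where
    t t′ : Fin (suc m) → Carrier
    t  j = -1^ (toℕ j) * N  zero j * det (λ i k → N  (suc i) (punchIn j k))
    t′ j = -1^ (toℕ j) * N′ zero j * det (λ i k → N′ (suc i) (punchIn j k))

    moved : t′ v ≈ -1^ (toℕ v) * t zero
    moved = begin
      -1^ (toℕ v) * N′ zero v * _    ≈⟨ *-cong (*-congˡ (eq₀ zero)) (det-cong λ i → eq₊ (suc i)) ⟩
      -1^ (toℕ v) * N zero zero * _  ≈⟨ *-assoc _ _ _ ⟩
      -1^ (toℕ v) * (N zero zero * _) ≈⟨ *-congˡ (*-congʳ (*-identityˡ _)) ⟨
      -1^ (toℕ v) * t zero           ∎

    shifted : ∀ m (v : Fin (suc m)) (N N′ : Matrix (suc m)) →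
      (∀ i → N′ i v ≈ N i zero) → (∀ i k → N′ i (punchIn v k) ≈ N i (suc k)) → ∀ k →
      -1^ (toℕ (punchIn v k)) * N′ zero (punchIn v k) *
        det (λ i l → N′ (suc i) (punchIn (punchIn v k) l)) ≈
      -1^ (toℕ v) *
        (-1^ (suc (toℕ k)) * N zero (suc k) * det (λ i l → N (suc i) (punchIn (suc k) l)))
    shifted (suc m) v N N′ eq₀ eq₊ k = begin
      -1^ (toℕ (punchIn v k)) * N′ zero (punchIn v k) * det minor′
        ≈⟨ *-cong (*-congˡ (eq₊ zero k)) (det-move-column (skip v k) minor minor′
             (λ i → ≈-trans (reflexive (cong (N′ (suc i)) (punchIn-skip v k))) (eq₀ (suc i)))
             (λ i l → ≈-trans (reflexive (cong (N′ (suc i)) (punchIn-punchIn-skip v k l)))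
               (eq₊ (suc i) (punchIn k l)))) ⟩
      -1^ (toℕ (punchIn v k)) * N zero (suc k) * (-1^ (toℕ (skip v k)) * det minor)
        ≈⟨ interchange _ _ _ _ ⟩
      -1^ (toℕ (punchIn v k)) * -1^ (toℕ (skip v k)) * (N zero (suc k) * det minor)
        ≈⟨ *-congʳ (sign-skip v k) ⟩
      -1^ (toℕ v) * -1^ (suc (toℕ k)) * (N zero (suc k) * det minor)
        ≈⟨ *-assoc _ _ _ ⟩
      -1^ (toℕ v) * (-1^ (suc (toℕ k)) * (N zero (suc k) * det minor))
        ≈⟨ *-congˡ (*-assoc _ _ _) ⟨
      -1^ (toℕ v) * (-1^ (suc (toℕ k)) * N zero (suc k) * det minor) ∎
      where
      minor minor′ : Matrix (suc m)
      minor  i l = N  (suc i) (punchIn (suc k) l)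
      minor′ i l = N′ (suc i) (punchIn (punchIn v k) l)

  step : ∀ {n} → Fin (suc n) → Carrier
  step zero    = 1#
  step (suc _) = - 1#

  sgn : ∀ {n} → Code n → Carrier
  sgn []      = 1#
  sgn (w ∷ κ) = step w * sgn κ

  -- The Laplace sign (-1)^(v + 1) of column `suc v` is split: (-1)^v moves column 0 of the minor
  -- into place `v`, which makes `redirect (suc v)` the column indexing, and a single - 1 remains as
  -- `step`.
  det-bordered : ∀ {n} (M : Matrix (suc n)) →
    det M ≈ sum λ w → step w * M zero w * det (λ i j → M (suc i) (redirect w j))
  det-bordered {n} M = sum-cong-≋ term
    where
    move : ∀ {n} (M : Matrix (suc n)) (v : Fin n) →
      det (λ i j → M (suc i) (redirect (suc v) j)) ≈
      -1^ (toℕ v) * det (λ i k → M (suc i) (punchIn (suc v) k))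
    move {suc n} M v = det-move-column v
      (λ i k → M (suc i) (punchIn (suc v) k)) (λ i j → M (suc i) (redirect (suc v) j))
      (λ i → reflexive (cong (M (suc i)) (redirect-≡ v)))
      (λ i k → reflexive (cong (M (suc i)) (redirect-≢ (Fin.punchInᵢ≢i v k))))

    term : ∀ w → -1^ (toℕ w) * M zero w * det (λ i k → M (suc i) (punchIn w k)) ≈
                 step w * M zero w * det (λ i j → M (suc i) (redirect w j))
    term zero    = ≈-refl
    term (suc v) = begin
      -1^ (suc (toℕ v)) * M zero (suc v) * d                      ≈⟨ xy∙z≈xz∙y _ _ _ ⟩
      - 1# * -1^ (toℕ v) * d * M zero (suc v)                     ≈⟨ *-congʳ (*-assoc _ _ _) ⟩
      - 1# * (-1^ (toℕ v) * d) * M zero (suc v)                   ≈⟨ *-congʳ (*-congˡ (move M v)) ⟨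
      - 1# * det (λ i j → M (suc i) (redirect (suc v) j)) * M zero (suc v) ≈⟨ xy∙z≈xz∙y _ _ _ ⟩
      - 1# * M zero (suc v) * det (λ i j → M (suc i) (redirect (suc v) j)) ∎
      where
      d = det (λ i k → M (suc i) (punchIn (suc v) k))

  sum≡∑allFin : ∀ {n} (t : Fin n → Carrier) → sum t ≡ ∑ (allFin n) t
  sum≡∑allFin {zero}  t = refl
  sum≡∑allFin {suc n} t =
    trans (cong (t zero ⊕_) (sum≡∑allFin (λ i → t (suc i)))) (sym (Sum.fold-allFin t))

  *-distribˡ-∑ : ∀ {A : Set} x (xs : List A) {f : A → Carrier} → x * ∑ xs f ≈ ∑ xs (λ y → x * f y)
  *-distribˡ-∑ x []       = zeroʳ x
  *-distribˡ-∑ x (y ∷ ys) = ≈-trans (distribˡ x _ _) (+-congˡ (*-distribˡ-∑ x ys))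

  -- The induction hypothesis is applied to the matrix with redirected columns, since
  -- `decode (w ∷ κ) (suc i)` is by definition `redirect w (decode κ i)`.
  leibniz : ∀ {n} (M : Matrix n) →
    det M ≈ ∑ (codes n) (λ κ → sgn κ * ∏ (allFin n) (λ i → M i (decode κ i)))
  leibniz {zero}  M = ≈-sym (≈-trans (+-identityʳ _) (*-identityˡ 1#))
  leibniz {suc n} M = begin
    det M                                      ≈⟨ det-bordered M ⟩
    sum (λ w → step w * M zero w * det (λ i j → M (suc i) (redirect w j)))
      ≈⟨ sum-cong-≋ row ⟩
    sum (λ w → ∑ (codes n) (λ κ → term (w ∷ κ)))
      ≈⟨ reflexive (sum≡∑allFin (λ w → ∑ (codes n) (λ κ → term (w ∷ κ)))) ⟩
    ∑ (allFin (suc n)) (λ w → ∑ (codes n) (λ κ → term (w ∷ κ)))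
      ≈⟨ Sum.fold-cartesianProductWith _∷_ (allFin (suc n)) (codes n) ⟨
    ∑ (codes (suc n)) term ∎
    where
    term : Code (suc n) → Carrier
    term κ = sgn κ * ∏ (allFin (suc n)) (λ i → M i (decode κ i))

    row : ∀ w → step w * M zero w * det (λ i j → M (suc i) (redirect w j)) ≈
                ∑ (codes n) (λ κ → term (w ∷ κ))
    row w = begin
      step w * M zero w * det (λ i j → M (suc i) (redirect w j))
        ≈⟨ *-congˡ (leibniz (λ i j → M (suc i) (redirect w j))) ⟩
      step w * M zero w *
        ∑ (codes n) (λ κ → sgn κ * ∏ (allFin n) (λ i → M (suc i) (redirect w (decode κ i))))
        ≈⟨ *-distribˡ-∑ _ (codes n) ⟩
      ∑ (codes n) (λ κ → step w * M zero w *
        (sgn κ * ∏ (allFin n) (λ i → M (suc i) (redirect w (decode κ i)))))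
        ≈⟨ Sum.fold-cong (codes n) (λ {κ} _ → ≈-trans (interchange _ _ _ _)
             (*-congˡ (reflexive (sym (Prod.fold-allFin (λ i → M i (decode (w ∷ κ) i))))))) ⟩
      ∑ (codes n) (λ κ → term (w ∷ κ)) ∎

-- Codes correspond to permutations

redirect≢w : ∀ {n} w (j : Fin n) → redirect w j ≢ w
redirect≢w (suc v) j eq with j ≟ v
redirect≢w (suc v) j refl | no ¬p = ¬p refl

redirect-injective : ∀ {n} w {i j : Fin n} → redirect w i ≡ redirect w j → i ≡ j
redirect-injective zero            eq = suc-injective eq
redirect-injective (suc v) {i} {j} eq with i ≟ v | j ≟ v
... | yes p | yes q = trans p (sym q)
... | no  _ | no  _ = suc-injective eq

redirect-surjective : ∀ {n} w {y : Fin (suc n)} → y ≢ w → ∃ λ j → redirect w j ≡ y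
redirect-surjective zero    {zero}  y≢w = contradiction refl y≢w
redirect-surjective zero    {suc j} y≢w = j , refl
redirect-surjective (suc v) {zero}  y≢w = v , redirect-≡ v
redirect-surjective (suc v) {suc j} y≢w = j , redirect-≢ (y≢w ∘ cong suc)

decode-injective : ∀ {n} (κ : Code n) → Injective _≡_ _≡_ (decode κ)
decode-injective (w ∷ κ) {zero}  {zero}  eq = refl
decode-injective (w ∷ κ) {zero}  {suc j} eq = contradiction (sym eq) (redirect≢w w (decode κ j))
decode-injective (w ∷ κ) {suc i} {zero}  eq = contradiction eq (redirect≢w w (decode κ i))
decode-injective (w ∷ κ) {suc i} {suc j} eq =
  cong suc (decode-injective κ (redirect-injective w eq))

decode-surjective : ∀ {n} (κ : Code n) y → ∃ λ x → decode κ x ≡ y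
decode-surjective (w ∷ κ) y with y ≟ w
... | yes y≡w = zero , sym y≡w
... | no  y≢w = let j , eq = redirect-surjective w y≢w
                    i , eq′ = decode-surjective κ j
                in suc i , trans (cong (redirect w) eq′) eq

decode-cancel : ∀ {n} {κ κ′ : Code n} → decode κ ≗ decode κ′ → κ ≡ κ′
decode-cancel {κ = []}    {[]}     eq = refl
decode-cancel {κ = w ∷ κ} {w′ ∷ κ′} eq with refl ← eq zero =
  cong (w ∷_) (decode-cancel (λ i → redirect-injective w (eq (suc i))))

-- Injectivity keeps `σ (suc i)` away from `σ zero`, so it lies in the image of `redirect (σ zero)`;
-- the preimages form the contracted permutation, which is injective again.
encode : ∀ {n} (σ : Fin n → Fin n) → Injective _≡_ _≡_ σ → ∃ λ κ → decode κ ≗ σ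
encode {zero}  σ inj = [] , λ ()
encode {suc n} σ inj = σ zero ∷ proj₁ rec , λ where
    zero    → refl
    (suc i) → trans (cong (redirect (σ zero)) (proj₂ rec i)) (proj₂ (contract i))
  where
  contract : ∀ i → ∃ λ j → redirect (σ zero) j ≡ σ (suc i)
  contract i = redirect-surjective (σ zero) (λ eq → 0≢1+n (sym (inj eq)))

  rec : ∃ λ κ → decode κ ≗ proj₁ ∘ contract
  rec = encode (proj₁ ∘ contract) λ {i} {j} eq → suc-injective (inj
    (trans (sym (proj₂ (contract i))) (trans (cong (redirect (σ zero)) eq) (proj₂ (contract j)))))

-- Duplicate-free lists and their rearrangement

module _ {A : Set} where

  Unique-resp-↭ : ∀ {xs ys : List A} → xs ↭ ys → Unique xs → Unique ys
  Unique-resp-↭ p = ↭ₛ.Unique-resp-↭ (≡.setoid A) (↭⇒↭ₛ p)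

  Unique-++⁻ˡ : ∀ xs {ys : List A} → Unique (xs ++ ys) → Unique xs
  Unique-++⁻ˡ []       _         = []
  Unique-++⁻ˡ (x ∷ xs) (px ∷ pxs) = All.++⁻ˡ xs px ∷ Unique-++⁻ˡ xs pxs

  Unique-++⇒disjoint : ∀ xs {ys : List A} {x} → Unique (xs ++ ys) → x ∈ xs → x ∉ ys
  Unique-++⇒disjoint (x ∷ xs) U        (here refl) x∈ys = Unique[x∷xs]⇒x∉xs U (∈-++⁺ʳ xs x∈ys)
  Unique-++⇒disjoint (_ ∷ xs) (_ ∷ U)  (there x∈)  x∈ys = Unique-++⇒disjoint xs U x∈ x∈ys

  Unique-++⁻ʳ : ∀ xs {ys : List A} → Unique (xs ++ ys) → Unique ys
  Unique-++⁻ʳ []       U       = U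
  Unique-++⁻ʳ (_ ∷ xs) (_ ∷ U) = Unique-++⁻ʳ xs U

  ∈⇒↭∷ : ∀ {x} {xs : List A} → x ∈ xs → ∃ λ ys → xs ↭ x ∷ ys
  ∈⇒↭∷ x∈xs with ys , zs , refl ← ∈-∃++ x∈xs = ys ++ zs , shift _ ys zs

module _ {A B : Set} (h : A → List B) where

  concatMap-↭ : ∀ {xs ys} → xs ↭ ys → concatMap h xs ↭ concatMap h ys
  concatMap-↭ ↭.refl        = ↭-refl
  concatMap-↭ (prep x p)    = ++⁺ˡ (h x) (concatMap-↭ p)
  concatMap-↭ (swap x y p)  =
    ↭-trans (shifts (h x) (h y)) (++⁺ˡ (h y) (++⁺ˡ (h x) (concatMap-↭ p)))
  concatMap-↭ (↭.trans p q) = ↭-trans (concatMap-↭ p) (concatMap-↭ q)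

  -- As no block is empty, a repeated `x` would repeat an element of its block.
  Unique-concatMap⁻ : (∀ x → ∃ (_∈ h x)) → ∀ xs → Unique (concatMap h xs) → Unique xs
  Unique-concatMap⁻ inh []       U = []
  Unique-concatMap⁻ inh (x ∷ xs) U =
    All.tabulate (λ { x′∈xs refl → let y , y∈hx = inh x in
      Unique-++⇒disjoint (h x) U y∈hx (∈-concatMap⁺ h (Any.map (λ { refl → y∈hx }) x′∈xs)) })
    ∷ Unique-concatMap⁻ inh xs (Unique-++⁻ʳ (h x) U)

-- Paths and closed walks

-- The list holds the interior vertices only, so `Path R b xs b` is a closed walk through `b ∷ xs`,
-- closing arc included.
Path : ∀ {A : Set} → (A → A → Set) → A → List A → A → Set
Path R u []       w = R u w
Path R u (x ∷ xs) w = R u x × Path R x xs w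

module _ {A : Set} {R : A → A → Set} where

  path-split : ∀ {u v w} xs {ys} → Path R u (xs ++ v ∷ ys) w → Path R u xs v × Path R v ys w
  path-split []       p       = p
  path-split (x ∷ xs) (r , p) = let p₁ , p₂ = path-split xs p in (r , p₁) , p₂

  path-join : ∀ {u v w} xs {ys} → Path R u xs v → Path R v ys w → Path R u (xs ++ v ∷ ys) w
  path-join []       r       q = r , q
  path-join (x ∷ xs) (r , p) q = r , path-join xs p q

  -- The side condition concerns heads of arcs, because undoing a contraction alters only the arc
  -- into one vertex.
  path-map : ∀ {B : Set} {S : B → B → Set} {P : A → Set} (f : A → B) →
    (∀ {x y} → P y → R x y → S (f x) (f y)) →
    ∀ {u w} xs → All P xs → P w → Path R u xs w → Path S (f u) (map f xs) (f w)
  path-map f hom []       []         pw r       = hom pw r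
  path-map {S = S} f hom (x ∷ xs) (px ∷ pxs) pw (r , p) = hom px r , path-map {S = S} f hom xs pxs pw p

  rotate : ∀ {b v} xs → v ∈ b ∷ xs → Path R b xs b → ∃ λ zs → Path R v zs v × v ∷ zs ↭ b ∷ xs
  rotate xs (here refl) p = xs , p , ↭-refl
  rotate {b} {v} xs (there v∈xs) p with xs₁ , xs₂ , refl ← ∈-∃++ v∈xs =
    let p₁ , p₂ = path-split xs₁ p
    in xs₂ ++ b ∷ xs₁ , path-join xs₂ p₂ p₁ , ++-comm (v ∷ xs₂) (b ∷ xs₁)

Graph : ∀ {A : Set} → (A → A) → A → A → Set
Graph σ u v = σ u ≡ v

-- Both paths follow the same function and end at their first arrival in `w`.
path-deterministic : ∀ {A : Set} {σ : A → A} {u w} xs ys → w ∉ xs → w ∉ ys →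
  Path (Graph σ) u xs w → Path (Graph σ) u ys w → xs ≡ ys
path-deterministic []       []       _    _    _          _          = refl
path-deterministic []       (y ∷ ys) _    w∉ys p          (q , _)    =
  contradiction (here (trans (sym p) q)) w∉ys
path-deterministic (x ∷ xs) []       w∉xs _    (p , _)    q          =
  contradiction (here (trans (sym q) p)) w∉xs
path-deterministic (x ∷ xs) (y ∷ ys) w∉xs w∉ys (refl , p) (refl , q) =
  cong (x ∷_) (path-deterministic xs ys (w∉xs ∘ there) (w∉ys ∘ there) p q)

-- Cycle decomposition of a coded permutation

-- Undoing a contraction with `suc v` amounts to composing with the transposition of 0 and `suc v`,
-- hence the name.
transpositions : ∀ {n} → Code n → ℕ
transpositions []          = 0
transpositions (zero ∷ κ)  = transpositions κ
transpositions (suc _ ∷ κ) = suc (transpositions κ)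

-- All cycles of σ, the fixed points included, each of them based at its least vertex.
record CycleSystem {n} (σ : Fin n → Fin n) : Set where
  field
    cycles    : List (Cycle n)
    closed    : ∀ {C} → C ∈ cycles → Path (Graph σ) (base C) (rest C) (base C)
    least     : ∀ {C} → C ∈ cycles → All (base C <_) (rest C)
    partition : concatMap vertices cycles ↭ allFin n

  partition-unique : Unique (concatMap vertices cycles)
  partition-unique = Unique-resp-↭ (↭-sym partition) (allFin⁺ n)

  cycles-unique : Unique cycles
  cycles-unique = Unique-concatMap⁻ vertices (λ C → base C , here refl) cycles partition-unique

  covering : ∀ v → ∃ λ C → C ∈ cycles × v ∈ vertices C
  covering v = find (∈-concatMap⁻ vertices (∈-resp-↭ (↭-sym partition) (∈-allFin v)))

  remove : ∀ {C} → C ∈ cycles → ∃ λ Cs →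
    cycles ↭ C ∷ Cs × vertices C ++ concatMap vertices Cs ↭ allFin n
  remove C∈cs = let Cs , p = ∈⇒↭∷ C∈cs in
    Cs , p , ↭-trans (↭-sym (concatMap-↭ vertices p)) partition

  vertices-unique : ∀ {C} → C ∈ cycles → Unique (vertices C)
  vertices-unique {C} C∈cs = let _ , _ , p = remove C∈cs in
    Unique-++⁻ˡ (vertices C) (Unique-resp-↭ (↭-sym p) (allFin⁺ n))

open CycleSystem

shiftCycle : ∀ {n} → Cycle n → Cycle (suc n)
shiftCycle (cycle b xs) = cycle (suc b) (map suc xs)

vertices-shift : ∀ {n} (Cs : List (Cycle n)) →
  concatMap vertices (map shiftCycle Cs) ≡ map suc (concatMap vertices Cs)
vertices-shift Cs = trans (concatMap-map vertices shiftCycle Cs) (sym (map-concatMap suc vertices Cs))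

allFin-suc : ∀ n → allFin (suc n) ≡ zero ∷ map suc (allFin n)
allFin-suc n = cong (zero ∷_) (sym (map-tabulate id suc))

-- A head `zero` adds a one-point cycle. A head `suc v` inserts 0 into the cycle through `v`:
-- rotated to start at `v`, it receives 0 in front, and the number of cycles stays the same while n
-- and `transpositions` both grow by one.
cycleSystem : ∀ {n} (κ : Code n) →
  ∃ λ (S : CycleSystem (decode κ)) → length (cycles S) + transpositions κ ≡ n
cycleSystem [] = record
  { cycles = [] ; closed = λ () ; least = λ () ; partition = ↭-refl } , refl
cycleSystem {suc n} (zero ∷ κ) = record
  { cycles    = cycle zero [] ∷ map shiftCycle Cs
  ; closed    = closed′
  ; least     = least′
  ; partition = ↭-trans (prep zero (↭-trans (↭-reflexive (vertices-shift Cs)) (↭-map⁺ suc (partition S))))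
                  (↭-reflexive (sym (allFin-suc n)))
  } , cong suc (trans (cong (_+ transpositions κ) (length-map shiftCycle Cs)) size)
  where
  S    = proj₁ (cycleSystem κ)
  size = proj₂ (cycleSystem κ)
  Cs   = cycles S

  closed′ : ∀ {C} → C ∈ cycle zero [] ∷ map shiftCycle Cs →
            Path (Graph (decode (zero ∷ κ))) (base C) (rest C) (base C)
  closed′ (here refl) = refl
  closed′ (there C∈) with C , C∈Cs , refl ← ∈-map⁻ shiftCycle C∈ =
    path-map {S = Graph (decode (zero ∷ κ))} {P = U} suc (λ _ → cong suc) (rest C)
      (All.universal-U _) tt (closed S C∈Cs)

  least′ : ∀ {C} → C ∈ cycle zero [] ∷ map shiftCycle Cs → All (base C <_) (rest C)
  least′ (here refl) = []
  least′ (there C∈) with C , C∈Cs , refl ← ∈-map⁻ shiftCycle C∈ =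
    All.map⁺ (All.map s≤s (least S C∈Cs))
cycleSystem {suc n} (suc v ∷ κ) = record
  { cycles    = new ∷ map shiftCycle Cs
  ; closed    = closed′
  ; least     = least′
  ; partition = prep zero (↭-trans (↭-reflexive (trans (cong (map suc (v ∷ zs) ++_) (vertices-shift Cs))
                    (sym (map-++ suc (v ∷ zs) _)))) (↭-map⁺ suc partition′))
                  ⟫ ↭-reflexive (sym (allFin-suc n))
  } , trans (cong (λ k → suc k + suc (transpositions κ)) (length-map shiftCycle Cs))
        (trans (ℕ.+-suc (suc (length Cs)) _)
          (cong suc (trans (cong (_+ transpositions κ) (sym (↭-length S↭))) size)))
  where
  _⟫_ = ↭-trans
  σ′   = decode (suc v ∷ κ)
  S    = proj₁ (cycleSystem κ)
  size = proj₂ (cycleSystem κ)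
  C₀   = proj₁ (covering S v)
  C₀∈  = proj₁ (proj₂ (covering S v))
  Cs   = proj₁ (remove S C₀∈)
  S↭   = proj₁ (proj₂ (remove S C₀∈))
  rot  = rotate (rest C₀) (proj₂ (proj₂ (covering S v))) (closed S C₀∈)
  zs   = proj₁ rot
  new  = cycle zero (map suc (v ∷ zs))

  partition′ : (v ∷ zs) ++ concatMap vertices Cs ↭ allFin n
  partition′ = ↭-trans (++⁺ʳ _ (proj₂ (proj₂ rot))) (proj₂ (proj₂ (remove S C₀∈)))

  unique′ : Unique ((v ∷ zs) ++ concatMap vertices Cs)
  unique′ = Unique-resp-↭ (↭-sym partition′) (allFin⁺ n)

  -- The walk from `v` back to `v` now ends at 0: only its last arc, the one into `v`, is
  -- redirected.
  open-path : ∀ {u} xs → v ∉ xs → Path (Graph (decode κ)) u xs v → Path (Graph σ′) (suc u) (map suc xs) zero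
  open-path []       v∉xs p       = trans (cong (redirect (suc v)) p) (redirect-≡ v)
  open-path (x ∷ xs) v∉xs (p , q) =
    trans (cong (redirect (suc v)) p) (redirect-≢ (v∉xs ∘ here ∘ sym)) ,
    open-path xs (v∉xs ∘ there) q

  closed′ : ∀ {C} → C ∈ new ∷ map shiftCycle Cs → Path (Graph σ′) (base C) (rest C) (base C)
  closed′ (here refl) = refl ,
    open-path zs (Unique[x∷xs]⇒x∉xs (Unique-++⁻ˡ (v ∷ zs) unique′)) (proj₁ (proj₂ rot))
  closed′ (there C∈) with C , C∈Cs , refl ← ∈-map⁻ shiftCycle C∈ =
    path-map {S = Graph σ′} suc
      (λ y≢v p → trans (cong (redirect (suc v)) p) (redirect-≢ y≢v)) (rest C)
      (All.tail v∉C) (All.head v∉C) (closed S (∈-resp-↭ (↭-sym S↭) (there C∈Cs)))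
    where
    -- The cycles partition the vertices, so the remaining ones avoid `v` and none of their arcs is
    -- redirected.
    v∉C : All (_≢ v) (vertices C)
    v∉C = All.tabulate λ { u∈C refl → Unique-++⇒disjoint (v ∷ zs) unique′ (here refl)
      (∈-concatMap⁺ vertices (Any.map (λ { refl → u∈C }) C∈Cs)) }

  least′ : ∀ {C} → C ∈ new ∷ map shiftCycle Cs → All (base C <_) (rest C)
  least′ (here refl) = All.map⁺ {f = suc} (All.universal (λ _ → s≤s z≤n) _)
  least′ (there C∈) with C , C∈Cs , refl ← ∈-map⁻ shiftCycle C∈ =
    All.map⁺ (All.map s≤s (least S (∈-resp-↭ (↭-sym S↭) (there C∈Cs))))

-- Exhaustive, duplicate-free enumerations

↭-from-unique : ∀ {A : Set} {xs ys : List A} → Unique xs → Unique ys →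
  (∀ {x} → x ∈ xs → x ∈ ys) → (∀ {x} → x ∈ ys → x ∈ xs) → xs ↭ ys
↭-from-unique U V f g = ∼bag⇒↭ (unique∧set⇒bag U V (mk⇔ f g))

module _ {A : Set} where

  ∈-words : ∀ {xs : List A} → (∀ x → x ∈ xs) → ∀ {n} (v : Vec A n) → v ∈ words xs n
  ∈-words all []      = here refl
  ∈-words all (x ∷ v) = ∈-cartesianProductWith⁺ _∷_ (all x) (∈-words all v)

  words-unique : ∀ {xs : List A} → Unique xs → ∀ n → Unique (words xs n)
  words-unique U zero    = [] ∷ []
  words-unique U (suc n) = cartesianProductWith⁺ _∷_ ∷-injective U (words-unique U n)

  toList-injective : ∀ {n} (v w : Vec A n) → toList v ≡ toList w → v ≡ w
  toList-injective []      []      eq   = refl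
  toList-injective (x ∷ v) (y ∷ w) eq with refl ← cong head eq =
    cong (x ∷_) (toList-injective v w (cong (drop 1) eq))

codes-unique : ∀ n → Unique (codes n)
codes-unique zero    = [] ∷ []
codes-unique (suc n) =
  cartesianProductWith⁺ _∷_ (λ { refl → refl , refl }) (allFin⁺ (suc n)) (codes-unique n)

∈-codes : ∀ {n} (κ : Code n) → κ ∈ codes n
∈-codes []      = here refl
∈-codes (w ∷ κ) = ∈-cartesianProductWith⁺ _∷_ (∈-allFin w) (∈-codes κ)

sides : List Side
sides = outside ∷ inside ∷ []

∈-sides : ∀ s → s ∈ sides
∈-sides outside = here refl
∈-sides inside  = there (here refl)

sides-unique : Unique sides
sides-unique = ((λ ()) ∷ []) ∷ [] ∷ []

∈-subdigraphs : ∀ {n} (H : Subdigraph n) → H ∈ subdigraphs n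
∈-subdigraphs {n} (subdigraph V arcs) =
  ∈-cartesianProductWith⁺ subdigraph (∈-words ∈-sides V) (∈-words (∈-words ∈-sides) arcs)

subdigraphs-unique : ∀ n → Unique (subdigraphs n)
subdigraphs-unique n = cartesianProductWith⁺ subdigraph (λ { refl → refl , refl })
  subsets-unique (words-unique subsets-unique n)
  where subsets-unique = words-unique sides-unique n

candidates : ∀ n → ℕ → List (Cycle n)
candidates n k = cartesianProductWith (λ v vs → cycle v (toList vs)) (allFin n) (words (allFin n) k)

∈-candidateCycles : ∀ {n} (C : Cycle n) → length (rest C) ℕ.< n → C ∈ candidateCycles n
∈-candidateCycles {n} (cycle b xs) len<n = ∈-concatMap⁺ (candidates n) (lose (∈-upTo⁺ len<n)
  (subst (λ ys → cycle b ys ∈ candidates n (length xs)) (toList∘fromList xs)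
    (∈-cartesianProductWith⁺ (λ v vs → cycle v (toList vs)) (∈-allFin b) (∈-words ∈-allFin (fromList xs)))))

-- The blocks for different `k` are disjoint because `k` can be read off as the length of `rest`.
candidateCycles-unique : ∀ n → Unique (candidateCycles n)
candidateCycles-unique n = concat⁺
  (All.map⁺ (All.universal
    (λ k → cartesianProductWith⁺ _ inj (allFin⁺ n) (words-unique (allFin⁺ n) k)) (upTo n)))
  (AllPairs.map⁺ (AllPairs.map (λ { k≢l (p , q) → k≢l (trans (sym (len p)) (len q)) }) (upTo⁺ n)))
  where
  inj : ∀ {k} {u v : Fin n} {us vs : Vec (Fin n) k} →
        cycle u (toList us) ≡ cycle v (toList vs) → u ≡ v × us ≡ vs
  inj eq = cong base eq , toList-injective _ _ (cong rest eq)

  len : ∀ {k C} → C ∈ candidates n k → length (rest C) ≡ k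
  len {k} C∈ with _ , vs , _ , _ , refl ← ∈-cartesianProductWith⁻ _ (allFin n) (words (allFin n) k) C∈ =
    length-toList vs

-- Subsets given by predicates, and subsets of size one

module _ {n} {P : Fin n → Set} (P? : Decidable P) where

  ∈-tabulate⁺ : ∀ {v} → P v → v ∈ˢ tabulate (does ∘ P?)
  ∈-tabulate⁺ {v} p = lookup⇒[]= v _ (trans (lookup∘tabulate _ v) (dec-true (P? v) p))

  ∈-tabulate⁻ : ∀ {v} → v ∈ˢ tabulate (does ∘ P?) → P v
  ∈-tabulate⁻ {v} v∈ with P? v | trans (sym (lookup∘tabulate (does ∘ P?) v)) ([]=⇒lookup v∈)
  ... | yes p | _ = p

∣p∣≡1⁺ : ∀ {n} {p : Subset n} {x} → x ∈ˢ p → (∀ {y} → y ∈ˢ p → y ≡ x) → ∣ p ∣ ≡ 1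
∣p∣≡1⁺ {p = p} {x} x∈p unique = trans (cong ∣_∣ (⊆-antisym
  (λ {y} y∈p → subst (_∈ˢ ⁅ x ⁆) (sym (unique y∈p)) (x∈⁅x⁆ x))
  (λ {y} y∈x → subst (_∈ˢ p) (sym (x∈⁅y⁆⇒x≡y x y∈x)) x∈p))) (∣⁅x⁆∣≡1 x)

-- Extracts from a degree equal to one the unique neighbour, from which a permutation can be built.
∣p∣≡1⁻ : ∀ {n} (p : Subset n) → ∣ p ∣ ≡ 1 → ∃ λ x → x ∈ˢ p × (∀ {y} → y ∈ˢ p → y ≡ x)
∣p∣≡1⁻ (inside ∷ p) eq = zero , here , λ where
  here → refl
  (there y∈p) →
    -- A further element of the tail would give it a cardinality above that of a smaller set, but
    -- the cardinality is 0.
    contradiction (ℕ.≤-trans (x∈p⇒∣p-x∣<∣p∣ y∈p) (ℕ.≤-reflexive (ℕ.suc-injective eq))) ℕ.n≮0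
∣p∣≡1⁻ (outside ∷ p) eq = let x , x∈p , unique = ∣p∣≡1⁻ p eq in
  suc x , there x∈p , λ { (there y∈p) → cong suc (unique y∈p) }

module _ {A : Set} {R : A → A → Set} where

  linked⇒path : ∀ {u w} xs → Linked R (u ∷ (xs ∷ʳ w)) → Path R u xs w
  linked⇒path []       (r ∷ _) = r
  linked⇒path (x ∷ xs) (r ∷ l) = r , linked⇒path xs l

  path⇒linked : ∀ {u w} xs → Path R u xs w → Linked R (u ∷ (xs ∷ʳ w))
  path⇒linked []       r       = r ∷ [-]
  path⇒linked (x ∷ xs) (r , p) = r ∷ path⇒linked xs p

  -- In contrast to `path-map`, the condition is on tails: on a closed walk these are all its
  -- vertices.
  path-weaken : ∀ {S : A → A → Set} {P : A → Set} → (∀ {x y} → P x → R x y → S x y) →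
    ∀ {u w} xs → All P (u ∷ xs) → Path R u xs w → Path S u xs w
  path-weaken f []       (pu ∷ []) r = f pu r
  path-weaken {S} f (x ∷ xs) (pu ∷ ps) (r , p) = f pu r , path-weaken {S} f xs ps p

  path-first : ∀ {u w} xs → Path R u xs w → ∃ (R u)
  path-first []       r       = _ , r
  path-first (x ∷ xs) (r , _) = _ , r

-- The digraph of moved points and its directed cycles

module _ {n} (σ : Fin n → Fin n) where

  moved? : Decidable (λ v → σ v ≢ v)
  moved? v = ¬? (σ v ≟ v)

  arc? : ∀ u → Decidable (λ v → σ u ≡ v × u ≢ v)
  arc? u v = (σ u ≟ v) ×-dec ¬? (u ≟ v)

  support : Subset n
  support = tabulate (does ∘ moved?)

  supportArcs : ArcSet n
  supportArcs = tabulate λ u → tabulate (does ∘ arc? u)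

  supportDigraph : Subdigraph n
  supportDigraph = subdigraph support supportArcs

  arc⁺ : ∀ {u v} → σ u ≡ v → u ≢ v → u ⟶[ supportArcs ] v
  arc⁺ {u} {v} eq u≢v = subst (v ∈ˢ_) (sym (lookup∘tabulate _ u)) (∈-tabulate⁺ (arc? u) (eq , u≢v))

  arc⁻ : ∀ {u v} → u ⟶[ supportArcs ] v → σ u ≡ v × u ≢ v
  arc⁻ {u} {v} uv = ∈-tabulate⁻ (arc? u) (subst (v ∈ˢ_) (lookup∘tabulate _ u) uv)

-- `encode` recovers a function only pointwise; since the digraph is tabulated from values,
-- pointwise equality suffices for equal digraphs.
supportDigraph-cong : ∀ {n} {σ τ : Fin n → Fin n} → σ ≗ τ → supportDigraph σ ≡ supportDigraph τ
supportDigraph-cong eq = cong₂ subdigraph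
  (tabulate-cong λ v → cong (λ w → does (¬? (w ≟ v))) (eq v))
  (tabulate-cong λ u → tabulate-cong λ v → cong (λ w → does ((w ≟ v) ×-dec ¬? (u ≟ v))) (eq u))

-- A moved point has an arc to its image, and this arc is also one of the other function; a point
-- moved by neither is fixed by both.
supportDigraph-cancel : ∀ {n} {σ τ : Fin n → Fin n} → supportDigraph σ ≡ supportDigraph τ → σ ≗ τ
supportDigraph-cancel {σ = σ} {τ} eq v with σ v ≟ v | τ v ≟ v
... | yes p | yes q = trans p (sym q)
... | no ¬p | _     =
  sym (proj₁ (arc⁻ τ (subst (λ H → v ⟶[ Subdigraph.arcs H ] σ v) eq (arc⁺ σ refl (¬p ∘ sym)))))
... | _     | no ¬q =
  proj₁ (arc⁻ σ (subst (λ H → v ⟶[ Subdigraph.arcs H ] τ v) (sym eq) (arc⁺ τ refl (¬q ∘ sym))))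

module _ {n} {σ : Fin n → Fin n} (S : CycleSystem σ) where

  nontrivial? : Decidable (λ (C : Cycle n) → σ (base C) ≢ base C)
  nontrivial? C = moved? σ (base C)

  -- Rotated to start at `u`, the cycle is a path from `u` to `u`; as `u` is fixed, so is the path
  -- with empty interior, and determinism identifies the two.
  fixed⇒singleton : ∀ {C u} → C ∈ cycles S → u ∈ vertices C → σ u ≡ u → vertices C ≡ u ∷ []
  fixed⇒singleton {C} C∈S u∈C fix with rotate (rest C) u∈C (closed S C∈S)
  ... | zs , p , zs↭ with refl ← path-deterministic zs []
          (Unique[x∷xs]⇒x∉xs (Unique-resp-↭ (↭-sym zs↭) (vertices-unique S C∈S))) (λ ()) p fix =
    ↭-singleton-inv (↭-sym zs↭)

  fixed-base : ∀ {C u} → C ∈ cycles S → u ∈ vertices C → σ u ≡ u → σ (base C) ≡ base C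
  fixed-base C∈S u∈C fix with refl ← fixed⇒singleton C∈S u∈C fix = fix

  fixed-vertex : ∀ {C u} → C ∈ cycles S → u ∈ vertices C → σ (base C) ≡ base C → σ u ≡ u
  fixed-vertex {C} C∈S u∈C fix with refl ← fixed⇒singleton C∈S (here refl) fix | u∈C
  ... | here refl = fix

  -- A cycle of σ is determined by any of its vertices, since its base is its least vertex.
  directedCycles⇒cycles : ∀ {C} → IsDirectedCycle (supportArcs σ) C →
                          C ∈ filter nontrivial? (cycles S)
  directedCycles⇒cycles {C} (linked , unique , b<) = same C∈S b∈C least′ zs↭ path
    where
    walk = linked⇒path (rest C) linked

    path : Path (Graph σ) (base C) (rest C) (base C)
    path = path-weaken {P = U} (λ _ → proj₁ ∘ arc⁻ σ) (rest C) (All.universal-U _) walk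

    nontrivial : σ (base C) ≢ base C
    nontrivial fix = let _ , r = path-first (rest C) walk ; eq , ≢ = arc⁻ σ r in ≢ (trans (sym fix) eq)

    C′ = proj₁ (covering S (base C))
    C∈S = proj₁ (proj₂ (covering S (base C)))
    b∈C = proj₂ (proj₂ (covering S (base C)))
    rot = rotate (rest C′) b∈C (closed S C∈S)
    least′ = least S C∈S

    -- The cycle of σ through `base C`, rotated to start there, follows σ until its first return,
    -- just as `C` does.
    zs↭ : vertices C ↭ vertices C′
    zs↭ = subst (λ zs → base C ∷ zs ↭ vertices C′)
      (path-deterministic _ _
        (Unique[x∷xs]⇒x∉xs (Unique-resp-↭ (↭-sym (proj₂ (proj₂ rot))) (vertices-unique S C∈S)))
        (Unique[x∷xs]⇒x∉xs unique) (proj₁ (proj₂ rot)) path)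
      (proj₂ (proj₂ rot))

    least-≤ : ∀ {C : Cycle n} {v} → All (base C <_) (rest C) → v ∈ vertices C → base C ≤ v
    least-≤ b< (here refl) = Fin.≤-refl
    least-≤ b< (there v∈)  = ℕ.<⇒≤ (All.lookup b< v∈)

    same : ∀ {C′} → C′ ∈ cycles S → base C ∈ vertices C′ → All (base C′ <_) (rest C′) →
      vertices C ↭ vertices C′ → Path (Graph σ) (base C) (rest C) (base C) →
      C ∈ filter nontrivial? (cycles S)
    -- Each base lies among the vertices of the other cycle and is least among its own, so the bases
    -- coincide.
    same {cycle b′ xs′} C′∈S b∈C′ b′< perm path
      with refl ← Fin.≤-antisym (least-≤ {cycle b′ xs′} b′< b∈C′)
                    (least-≤ {C} b< (∈-resp-↭ (↭-sym perm) (here refl)))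
      with refl ← path-deterministic (rest C) xs′ (Unique[x∷xs]⇒x∉xs unique)
                    (Unique[x∷xs]⇒x∉xs (vertices-unique S C′∈S)) path (closed S C′∈S) =
      ∈-filter⁺ nontrivial? C′∈S nontrivial

  -- One fixed vertex would make the base fixed, so every step along a nontrivial cycle is an arc.
  cycles⇒directedCycles : ∀ {C} → C ∈ filter nontrivial? (cycles S) →
                          C ∈ directedCycles (supportArcs σ)
  cycles⇒directedCycles {C} C∈ with C∈S , nontrivial ← ∈-filter⁻ nontrivial? C∈ =
    ∈-filter⁺ (isDirectedCycle? (supportArcs σ)) (∈-candidateCycles C length<n)
      ( path⇒linked (rest C) (path-weaken {P = λ u → σ u ≢ u}
          (λ {u} u≢ eq → arc⁺ σ eq (λ { refl → u≢ eq })) (rest C)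
          (All.tabulate (λ u∈C fix → nontrivial (fixed-base C∈S u∈C fix))) (closed S C∈S))
      , vertices-unique S C∈S
      , least S C∈S)
    where
    -- The vertices of `C` form one block of a partition of n vertices, which puts `C` within the
    -- range of the search.
    length<n : length (rest C) ℕ.< n
    length<n = let _ , _ , p = remove S C∈S in
      subst (suc (length (rest C)) ℕ.≤_)
        (trans (sym (length-++ (vertices C))) (trans (↭-length p) (length-tabulate id)))
        (ℕ.m≤m+n _ _)

  -- Both `c` and the gain are defined through the search for cycles; this replaces the search by
  -- the cycles of σ other than fixed points.
  directedCycles-support : directedCycles (supportArcs σ) ↭ filter nontrivial? (cycles S)
  directedCycles-support = ↭-from-unique
    (filter⁺ (isDirectedCycle? (supportArcs σ)) (candidateCycles-unique n))
    (filter⁺ nontrivial? (cycles-unique S))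
    (λ C∈ → directedCycles⇒cycles
      (proj₂ (∈-filter⁻ (isDirectedCycle? (supportArcs σ)) {xs = candidateCycles n} C∈)))
    cycles⇒directedCycles

-- Elementary subdigraphs as supports of permutations

module _ {n} (D : Digraph n) where
  private module D = Digraph D

  FollowsArcs : (Fin n → Fin n) → Set
  FollowsArcs σ = ∀ v → σ v ≢ v → v ⟶[ D.arcs ] σ v

  followsArcs? : Decidable FollowsArcs
  followsArcs? σ = all? λ v → moved? σ v →-dec (v ⟶[ D.arcs ]? σ v)

  -- Injectivity makes the image of a moved point moved. For in-degrees, surjectivity provides a
  -- predecessor, distinct from the vertex since that is moved, and injectivity makes it unique.
  support-elementary : ∀ {σ} → Injective _≡_ _≡_ σ → (∀ y → ∃ λ x → σ x ≡ y) → FollowsArcs σ →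
                       IsElementary D (supportDigraph σ)
  support-elementary {σ} inj surj follows = sub , degrees
    where
    head-moved : ∀ {u} → σ u ≢ u → σ (σ u) ≢ σ u
    head-moved u≢ fix = u≢ (inj fix)

    sub : ∀ u v → u ⟶[ supportArcs σ ] v → u ⟶[ D.arcs ] v × u ∈ˢ support σ × v ∈ˢ support σ
    sub u v uv with refl , u≢ ← arc⁻ σ uv =
      follows u (u≢ ∘ sym) , ∈-tabulate⁺ (moved? σ) (u≢ ∘ sym) ,
      ∈-tabulate⁺ (moved? σ) (head-moved (u≢ ∘ sym))

    degrees : ∀ v → v ∈ˢ support σ → inDegree (supportArcs σ) v ≡ 1 × outDegree (supportArcs σ) v ≡ 1
    degrees v v∈ with surj v
    ... | u , refl =
      ∣p∣≡1⁺ (∈-tabulate⁺ (λ x → x ⟶[ supportArcs σ ]? σ u) (arc⁺ σ refl u≢))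
        (λ y∈ → inj (proj₁ (arc⁻ σ (∈-tabulate⁻ (λ x → x ⟶[ supportArcs σ ]? σ u) y∈)))) ,
      ∣p∣≡1⁺ (arc⁺ σ refl (moved ∘ sym)) (λ y∈ → sym (proj₁ (arc⁻ σ y∈)))
      where
      moved = ∈-tabulate⁻ (moved? σ) v∈

      u≢ : u ≢ σ u
      u≢ eq = moved (cong σ (sym eq))

  -- σ follows the unique outgoing arc on `V` and is the identity elsewhere. As `D` has no loops,
  -- the moved points are then exactly `V`.
  elementary-support : ∀ {H} → IsElementary D H →
    ∃ λ σ → Injective _≡_ _≡_ σ × FollowsArcs σ × supportDigraph σ ≡ H
  elementary-support {H} (sub , degrees) = σ , inj , follows , cong₂ subdigraph V≡ arcs≡
    where
    open Subdigraph H using (V; arcs)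

    out : ∀ {u} → u ∈ˢ V → ∃ λ x → x ∈ˢ lookup arcs u × (∀ {y} → y ∈ˢ lookup arcs u → y ≡ x)
    out u∈V = ∣p∣≡1⁻ _ (proj₂ (degrees _ u∈V))

    σ-by : ∀ {u} → Dec (u ∈ˢ V) → Fin n
    σ-by     (yes u∈V) = proj₁ (out u∈V)
    σ-by {u} (no  _)   = u

    σ : Fin n → Fin n
    σ u = σ-by (u ∈? V)

    arc⇒σ : ∀ {u v} → u ⟶[ arcs ] v → σ u ≡ v
    arc⇒σ {u} {v} uv with u ∈? V
    ... | yes u∈V = sym (proj₂ (proj₂ (out u∈V)) uv)
    ... | no  u∉V = contradiction (proj₁ (proj₂ (sub u v uv))) u∉V

    V⇒arc : ∀ {u} → u ∈ˢ V → u ⟶[ arcs ] σ u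
    V⇒arc {u} u∈V with u ∈? V
    ... | yes u∈V = proj₁ (proj₂ (out u∈V))
    ... | no  u∉V = contradiction u∈V u∉V

    ∉V⇒fixed : ∀ {u} → u ∉ˢ V → σ u ≡ u
    ∉V⇒fixed {u} u∉V with u ∈? V
    ... | yes u∈V = contradiction u∈V u∉V
    ... | no  _   = refl

    V⇒moved : ∀ {u} → u ∈ˢ V → σ u ≢ u
    V⇒moved {u} u∈V fix = D.loopless u (proj₁ (sub u u (subst (u ⟶[ arcs ]_) fix (V⇒arc u∈V))))

    moved⇒V : ∀ {u} → σ u ≢ u → u ∈ˢ V
    moved⇒V {u} moved with u ∈? V
    ... | yes u∈V = u∈V
    ... | no  _   = contradiction refl moved

    σ∈V : ∀ {u} → u ∈ˢ V → σ u ∈ˢ V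
    σ∈V u∈V = proj₂ (proj₂ (sub _ _ (V⇒arc u∈V)))

    follows : FollowsArcs σ
    follows v moved = proj₁ (sub _ _ (V⇒arc (moved⇒V moved)))

    inj : Injective _≡_ _≡_ σ
    inj {u} {v} eq = by (u ∈? V) (v ∈? V)
      where
      -- Within `V` the in-degree one decides; the mixed cases are impossible because σ maps `V`
      -- into itself and fixes everything else.
      by : Dec (u ∈ˢ V) → Dec (v ∈ˢ V) → u ≡ v
      by (yes u∈V) (yes v∈V) =
        let _ , _ , unique = ∣p∣≡1⁻ _ (proj₁ (degrees (σ u) (σ∈V u∈V)))
            into = λ x → x ⟶[ arcs ]? σ u
        in trans (unique (∈-tabulate⁺ into (V⇒arc u∈V)))
             (sym (unique (∈-tabulate⁺ into (subst (v ⟶[ arcs ]_) (sym eq) (V⇒arc v∈V)))))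
      by (yes u∈V) (no v∉V) = contradiction (subst (_∈ˢ V) (trans eq (∉V⇒fixed v∉V)) (σ∈V u∈V)) v∉V
      by (no u∉V) (yes v∈V) = contradiction (subst (_∈ˢ V) (trans (sym eq) (∉V⇒fixed u∉V)) (σ∈V v∈V)) u∉V
      by (no u∉V) (no v∉V)  = trans (sym (∉V⇒fixed u∉V)) (trans eq (∉V⇒fixed v∉V))

    V≡ : support σ ≡ V
    V≡ = ⊆-antisym (λ v∈ → moved⇒V (∈-tabulate⁻ (moved? σ) v∈)) (λ v∈ → ∈-tabulate⁺ (moved? σ) (V⇒moved v∈))

    arcs≡ : supportArcs σ ≡ arcs
    arcs≡ = trans (tabulate-cong λ u → ⊆-antisym {i = tabulate (does ∘ arc? σ u)}
        (λ {v} v∈ → let eq , u≢v = ∈-tabulate⁻ (arc? σ u) v∈ in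
          subst (u ⟶[ arcs ]_) eq (V⇒arc (moved⇒V (λ fix → u≢v (trans (sym fix) eq)))))
        (λ {v} uv → ∈-tabulate⁺ (arc? σ u)
          (arc⇒σ uv , λ { refl → D.loopless u (proj₁ (sub u u uv)) })))
      (tabulate∘lookup arcs)

  elementarySupports : List (Subdigraph n)
  elementarySupports = map (supportDigraph ∘ decode) (filter (followsArcs? ∘ decode) (codes n))

  elementarySupports↭𝓔 : elementarySupports ↭ 𝓔 D
  elementarySupports↭𝓔 = ↭-from-unique
    (map⁺ (decode-cancel ∘ supportDigraph-cancel) (filter⁺ (followsArcs? ∘ decode) (codes-unique n)))
    (filter⁺ (isElementary? D) (subdigraphs-unique n)) to from
    where
    to : ∀ {H} → H ∈ elementarySupports → H ∈ 𝓔 D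
    to H∈ with κ , κ∈ , refl ← ∈-map⁻ (supportDigraph ∘ decode) H∈ =
      ∈-filter⁺ (isElementary? D) (∈-subdigraphs _)
        (support-elementary (decode-injective κ) (decode-surjective κ)
          (proj₂ (∈-filter⁻ (followsArcs? ∘ decode) {xs = codes n} κ∈)))

    from : ∀ {H} → H ∈ 𝓔 D → H ∈ elementarySupports
    from {H} H∈ =
      let σ , inj , follows , H≡ =
            elementary-support {H} (proj₂ (∈-filter⁻ (isElementary? D) {xs = subdigraphs n} H∈))
          κ , eq = encode σ inj
      in subst (_∈ elementarySupports) (trans (supportDigraph-cong eq) H≡)
           (∈-map⁺ (supportDigraph ∘ decode) (∈-filter⁺ (followsArcs? ∘ decode) (∈-codes κ)
             (λ v moved → subst (v ⟶[ D.arcs ]_) (sym (eq v)) (follows v (moved ∘ trans (eq v))))))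

-- Expansion over elementary subdigraphs in any commutative ring

module Expansion {c ℓ} (R : CommutativeRing c ℓ) where

  open CommutativeRing R hiding (zero)
    renaming (refl to ≈-refl; sym to ≈-sym; trans to ≈-trans; _+_ to _⊕_)
  open LinearAlgebra R
  open Determinant R
  open Prod using (restrict; restrict-∈; restrict-∉)
  open import Algebra.Properties.Ring ring using (-1*x≈-x; -0#≈0#)
  open import Algebra.Properties.Semiring.Exp semiring using (_^_; ^-homo-*; ^-congʳ)
  open import Algebra.Properties.CommutativeSemigroup *-commutativeSemigroup
    using (interchange; x∙yz≈y∙xz)
  open import Relation.Binary.Reasoning.Setoid setoid

  -- The counterpart of `walkGain` for an arbitrary matrix and ring; the expansion uses no property
  -- of complex numbers or of modulus one.
  walkProduct : ∀ {n} → Matrix n → List (Fin n) → Carrier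
  walkProduct A (u ∷ v ∷ vs) = A u v * walkProduct A (v ∷ vs)
  walkProduct A _            = 1#

  walkProduct-path : ∀ {n} (A : Matrix n) {σ : Fin n → Fin n} {u w} xs → Path (Graph σ) u xs w →
    walkProduct A (u ∷ (xs ∷ʳ w)) ≈ ∏ (u ∷ xs) (λ v → A v (σ v))
  walkProduct-path A []       refl       = ≈-refl
  walkProduct-path A (x ∷ xs) (refl , p) = *-congˡ (walkProduct-path A xs p)

  gain : ∀ {n} → Matrix n → Subdigraph n → Carrier
  gain A H = ∏ (directedCycles (Subdigraph.arcs H)) (walkProduct A ∘ closedWalk)

  ∏-restrict-const : ∀ {n} {P : Fin n → Set} (P? : Decidable P) x →
    ∏ (allFin n) (restrict P? (λ _ → x)) ≈ x ^ ∣ tabulate (does ∘ P?) ∣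
  ∏-restrict-const {zero}  P? x = ≈-refl
  ∏-restrict-const {suc n} P? x =
    ≈-trans (reflexive (Prod.fold-allFin (restrict P? (λ _ → x)))) (first (∏-restrict-const (P? ∘ suc) x))
    where
    first : ∀ {y} → y ≈ x ^ ∣ tabulate (does ∘ P? ∘ suc) ∣ →
            restrict P? (λ _ → x) zero * y ≈ x ^ ∣ tabulate (does ∘ P?) ∣
    first eq with does (P? zero)
    ... | true  = *-congˡ eq
    ... | false = ≈-trans (*-identityˡ _) eq

  ∏-1 : ∀ {A : Set} (xs : List A) {f : A → Carrier} → (∀ {x} → x ∈ xs → f x ≈ 1#) → ∏ xs f ≈ 1#
  ∏-1 []       eq = ≈-refl
  ∏-1 (x ∷ xs) eq = ≈-trans (*-cong (eq (here refl)) (∏-1 xs (eq ∘ there))) (*-identityˡ 1#)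

  ∏-0 : ∀ {A : Set} {xs : List A} {f : A → Carrier} {x} → x ∈ xs → f x ≈ 0# → ∏ xs f ≈ 0#
  ∏-0 (here refl) eq = ≈-trans (*-congʳ eq) (zeroˡ _)
  ∏-0 (there x∈)  eq = ≈-trans (*-congˡ (∏-0 x∈ eq)) (zeroʳ _)

  ∏-const : ∀ {A : Set} (xs : List A) x → ∏ xs (λ _ → x) ≡ x ^ length xs
  ∏-const []       x = refl
  ∏-const (_ ∷ xs) x = cong (x *_) (∏-const xs x)

  -1^k*-1^k : ∀ k → -1^ k * -1^ k ≈ 1#
  -1^k*-1^k zero    = *-identityˡ 1#
  -1^k*-1^k (suc k) = ≈-trans (interchange _ _ _ _) (≈-trans (*-assoc _ _ _) (≈-trans (-1*-1* _) (-1^k*-1^k k)))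

  sgn-transpositions : ∀ {n} (κ : Code n) → sgn κ ≈ -1^ (transpositions κ)
  sgn-transpositions []          = ≈-refl
  sgn-transpositions (zero ∷ κ)  = ≈-trans (*-identityˡ _) (sgn-transpositions κ)
  sgn-transpositions (suc _ ∷ κ) = *-congˡ (sgn-transpositions κ)

  module _ {n} {σ : Fin n → Fin n} (S : CycleSystem σ) where

    ∏-cycles : ∀ (f : Fin n → Carrier) →
      ∏ (allFin n) f ≈ ∏ (cycles S) (λ C → ∏ (vertices C) f)
    ∏-cycles f = ≈-trans (Prod.fold-↭ (↭-sym (partition S))) (Prod.fold-concatMap vertices (cycles S))

    -- A cycle consists either of moved points only or of fixed points only, so the restriction can
    -- be carried out cycle by cycle.
    ∏-moved : ∀ (f : Fin n → Carrier) → ∏ (allFin n) (restrict (moved? σ) f) ≈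
      ∏ (filter (nontrivial? S) (cycles S)) (λ C → ∏ (vertices C) f)
    ∏-moved f = begin
      ∏ (allFin n) (restrict (moved? σ) f)
        ≈⟨ ∏-cycles _ ⟩
      ∏ (cycles S) (λ C → ∏ (vertices C) (restrict (moved? σ) f))
        ≈⟨ Prod.fold-cong (cycles S) on-cycle ⟩
      ∏ (cycles S) (restrict (nontrivial? S) (λ C → ∏ (vertices C) f))
        ≈⟨ Prod.fold-filter (nontrivial? S) (cycles S) ⟨
      ∏ (filter (nontrivial? S) (cycles S)) (λ C → ∏ (vertices C) f) ∎
      where
      on-cycle : ∀ {C} → C ∈ cycles S →
        ∏ (vertices C) (restrict (moved? σ) f) ≈ restrict (nontrivial? S) (λ C → ∏ (vertices C) f) C
      on-cycle {C} C∈S = by (σ (base C) ≟ base C)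
        where
        by : Dec (σ (base C) ≡ base C) → _
        by (yes fix) = ≈-trans
          (∏-1 (vertices C) (λ {u} u∈C →
            restrict-∉ (moved? σ) f u (λ moved → moved (fixed-vertex S C∈S u∈C fix))))
          (≈-sym (restrict-∉ (nontrivial? S) (λ C → ∏ (vertices C) f) C (λ ≢ → ≢ fix)))
        by (no ≢) = ≈-trans
          (Prod.fold-cong (vertices C) (λ {u} u∈C → restrict-∈ (moved? σ) f u (≢ ∘ fixed-base S C∈S u∈C)))
          (≈-sym (restrict-∈ (nontrivial? S) (λ C → ∏ (vertices C) f) C ≢))

    parity : -1^ (length (cycles S)) * -1^ n ≈
             -1^ (length (filter (nontrivial? S) (cycles S))) * -1^ ∣ support σ ∣
    parity = begin
      -1^ (length (cycles S)) * -1^ n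
        ≈⟨ *-cong (reflexive (∏-const (cycles S) (- 1#)))
             (≈-trans (reflexive (∏-const (allFin n) (- 1#)))
               (^-congʳ (- 1#) (length-tabulate {n = n} id))) ⟨
      ∏ (cycles S) (λ _ → - 1#) * ∏ (allFin n) (λ _ → - 1#)
        ≈⟨ *-congˡ (∏-cycles _) ⟩
      ∏ (cycles S) (λ _ → - 1#) * ∏ (cycles S) (λ C → ∏ (vertices C) (λ _ → - 1#))
        ≈⟨ Prod.fold-∙ (cycles S) ⟨
      ∏ (cycles S) weight
        ≈⟨ Prod.fold-cong (cycles S) on-cycle ⟩
      ∏ (cycles S) (restrict (nontrivial? S) weight)
        ≈⟨ Prod.fold-filter (nontrivial? S) (cycles S) ⟨
      ∏ (filter (nontrivial? S) (cycles S)) weight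
        ≈⟨ Prod.fold-∙ (filter (nontrivial? S) (cycles S)) ⟩
      ∏ (filter (nontrivial? S) (cycles S)) (λ _ → - 1#) *
      ∏ (filter (nontrivial? S) (cycles S)) (λ C → ∏ (vertices C) (λ _ → - 1#))
        ≈⟨ *-cong (reflexive (∏-const (filter (nontrivial? S) (cycles S)) (- 1#)))
             (≈-trans (≈-sym (∏-moved _)) (∏-restrict-const (moved? σ) (- 1#))) ⟩
      -1^ (length (filter (nontrivial? S) (cycles S))) * -1^ ∣ support σ ∣ ∎
      where
      weight : Cycle n → Carrier
      weight C = - 1# * ∏ (vertices C) (λ _ → - 1#)

      on-cycle : ∀ {C} → C ∈ cycles S → weight C ≈ restrict (nontrivial? S) weight C
      on-cycle {C} C∈S = by (σ (base C) ≟ base C)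
        where
        by : Dec (σ (base C) ≡ base C) → _
        by (yes fix) = ≈-trans
          (reflexive (cong (λ us → - 1# * ∏ us (λ _ → - 1#)) (fixed⇒singleton S C∈S (here refl) fix)))
          (≈-trans (-1*-1* 1#) (≈-sym (restrict-∉ (nontrivial? S) weight C (λ ≢ → ≢ fix))))
        by (no ≢) = ≈-sym (restrict-∈ (nontrivial? S) weight C ≢)

    ∏-moved-gain : ∀ (A : Matrix n) →
      ∏ (allFin n) (restrict (moved? σ) (λ v → A v (σ v))) ≈
      gain A (supportDigraph σ)
    ∏-moved-gain A = begin
      ∏ (allFin n) (restrict (moved? σ) (λ v → A v (σ v)))
        ≈⟨ ∏-moved _ ⟩
      ∏ (filter (nontrivial? S) (cycles S)) (λ C → ∏ (vertices C) (λ v → A v (σ v)))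
        ≈⟨ Prod.fold-cong (filter (nontrivial? S) (cycles S)) (λ {C} C∈ →
             ≈-sym (walkProduct-path A (rest C) (closed S (proj₁ (∈-filter⁻ (nontrivial? S) C∈))))) ⟩
      ∏ (filter (nontrivial? S) (cycles S)) (walkProduct A ∘ closedWalk)
        ≈⟨ Prod.fold-↭ (directedCycles-support S) ⟨
      gain A (supportDigraph σ) ∎

  sgn-support : ∀ {n} (κ : Code n) →
    sgn κ ≈ -1^ (∣ support (decode κ) ∣ + length (directedCycles (supportArcs (decode κ))))
  sgn-support {n} κ = begin
    sgn κ                                ≈⟨ sgn-transpositions κ ⟩
    -1^ t                                ≈⟨ *-identityˡ _ ⟨
    -- Inserting the square of (-1)^l turns the exponent t into l + t = n and avoids subtraction.
    1# * -1^ t                           ≈⟨ *-congʳ (-1^k*-1^k l) ⟨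
    -1^ l * -1^ l * -1^ t                ≈⟨ *-assoc _ _ _ ⟩
    -1^ l * (-1^ l * -1^ t)              ≈⟨ *-congˡ (^-homo-* (- 1#) l t) ⟨
    -1^ l * -1^ (l + t)                  ≈⟨ *-congˡ (^-congʳ (- 1#) (proj₂ (cycleSystem κ))) ⟩
    -1^ l * -1^ n                        ≈⟨ parity S ⟩
    -1^ (length (filter (nontrivial? S) (cycles S))) * -1^ ∣ support σ ∣
      ≈⟨ *-comm _ _ ⟩
    -1^ ∣ support σ ∣ * -1^ (length (filter (nontrivial? S) (cycles S)))
      ≈⟨ ^-homo-* (- 1#) ∣ support σ ∣ _ ⟨
    -1^ (∣ support σ ∣ + length (filter (nontrivial? S) (cycles S)))
      ≈⟨ ^-congʳ (- 1#) (cong (∣ support σ ∣ +_) (↭-length (directedCycles-support S))) ⟨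
    -1^ (∣ support σ ∣ + length (directedCycles (supportArcs σ))) ∎
    where
    σ = decode κ
    S = proj₁ (cycleSystem κ)
    t = transpositions κ
    l = length (cycles S)

  module _ {n} (D : Digraph n) (A : Matrix n) (d : Fin n → Carrier)
           (A-support : ∀ {u v} → ¬ (u ⟶[ Digraph.arcs D ] v) → A u v ≈ 0#) where

    -- e is - 1# for L and 1# for Q.
    module _ (e : Carrier) (M : Matrix n)
             (M-diagonal : ∀ u → M u u ≈ d u) (M-arc : ∀ {u v} → u ≢ v → M u v ≈ e * A u v) where

      -- The common form of both formulas: for `e` equal to `- 1#` the factor in front cancels
      -- (-1)^|V|, for `1#` it disappears.
      summand : Subdigraph n → Carrier
      summand H = e ^ ∣ Subdigraph.V H ∣ *
        (-1^ (∣ Subdigraph.V H ∣ + Subdigraph.c H) * gain A H * ∏ (uncovered H) d)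

      -- Every entry is written as `E v * (F v * G v)`, each factor being 1 off its own set of
      -- vertices, so that the product separates.
      ∏-entries : ∀ {σ} → CycleSystem σ → ∏ (allFin n) (λ v → M v (σ v)) ≈
        e ^ ∣ support σ ∣ * (gain A (supportDigraph σ) * ∏ (uncovered (supportDigraph σ)) d)
      ∏-entries {σ} S = begin
        ∏ (allFin n) (λ v → M v (σ v))
          ≈⟨ Prod.fold-cong (allFin n) (λ {v} _ → entry v) ⟩
        ∏ (allFin n) (λ v → E v * (F v * G v))
          ≈⟨ Prod.fold-∙ (allFin n) ⟩
        ∏ (allFin n) E * ∏ (allFin n) (λ v → F v * G v)
          ≈⟨ *-cong (∏-restrict-const (moved? σ) e) (Prod.fold-∙ (allFin n)) ⟩
        e ^ ∣ support σ ∣ * (∏ (allFin n) F * ∏ (allFin n) G)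
          ≈⟨ *-congˡ (*-cong (∏-moved-gain S A) (≈-sym (Prod.fold-filter uncovered? (allFin n)))) ⟩
        e ^ ∣ support σ ∣ * (gain A (supportDigraph σ) * ∏ (uncovered (supportDigraph σ)) d) ∎
        where
        uncovered? = λ v → ¬? (v ∈? support σ)

        arcEntry E F G : Fin n → Carrier
        arcEntry v = A v (σ v)
        E = restrict (moved? σ) (λ _ → e)
        F = restrict (moved? σ) arcEntry
        G = restrict uncovered? d

        entry : ∀ v → M v (σ v) ≈ E v * (F v * G v)
        entry v = by (σ v ≟ v)
          where
          by : Dec (σ v ≡ v) → _
          by (yes fix) = begin
            M v (σ v)           ≈⟨ reflexive (cong (M v) fix) ⟩
            M v v               ≈⟨ M-diagonal v ⟩
            d v                 ≈⟨ restrict-∈ uncovered? d v (λ v∈ → ∈-tabulate⁻ (moved? σ) v∈ fix) ⟨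
            G v                 ≈⟨ *-identityˡ _ ⟨
            1# * G v            ≈⟨ *-identityˡ _ ⟨
            1# * (1# * G v)
              ≈⟨ *-cong (restrict-∉ (moved? σ) (λ _ → e) v (λ ≢ → ≢ fix))
                   (*-congʳ (restrict-∉ (moved? σ) arcEntry v (λ ≢ → ≢ fix))) ⟨
            E v * (F v * G v)   ∎
          by (no moved) = begin
            M v (σ v)               ≈⟨ M-arc (moved ∘ sym) ⟩
            e * A v (σ v)
              ≈⟨ *-cong (restrict-∈ (moved? σ) (λ _ → e) v moved) (restrict-∈ (moved? σ) arcEntry v moved) ⟨
            E v * F v               ≈⟨ *-congˡ (*-identityʳ _) ⟨
            E v * (F v * 1#)
              ≈⟨ *-congˡ (*-congˡ (restrict-∉ uncovered? d v (λ v∉ → v∉ (∈-tabulate⁺ (moved? σ) moved)))) ⟨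
            E v * (F v * G v)       ∎

      term-support : ∀ κ →
        sgn κ * ∏ (allFin n) (λ v → M v (decode κ v)) ≈ summand (supportDigraph (decode κ))
      term-support κ = begin
        sgn κ * ∏ (allFin n) (λ v → M v (decode κ v))
          ≈⟨ *-cong (sgn-support κ) (∏-entries (proj₁ (cycleSystem κ))) ⟩
        _ * (e ^ ∣ support (decode κ) ∣ * _)    ≈⟨ x∙yz≈y∙xz _ _ _ ⟩
        e ^ ∣ support (decode κ) ∣ * (_ * _)    ≈⟨ *-congˡ (*-assoc _ _ _) ⟨
        summand (supportDigraph (decode κ))     ∎

      term-vanishes : ∀ {σ} → ¬ FollowsArcs D σ → ∏ (allFin n) (λ v → M v (σ v)) ≈ 0#
      term-vanishes {σ} ¬follows
        with v , bad ← ¬∀⟶∃¬ n _ (λ v → moved? σ v →-dec (v ⟶[ Digraph.arcs D ]? σ v)) ¬follows =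
        -- `bad` refutes an implication: a fixed `v` would satisfy it vacuously, so `v` is moved; an
        -- arc would satisfy it too, so the entry of `A` is zero.
        ∏-0 (∈-allFin v) (≈-trans (M-arc (bad ∘ fixed)) (≈-trans (*-congˡ (A-support (λ a → bad (λ _ → a)))) (zeroʳ e)))
        where
        fixed : ∀ {v} → v ≡ σ v → σ v ≢ v → v ⟶[ Digraph.arcs D ] σ v
        fixed eq moved = contradiction (sym eq) moved

      det-expansion : det M ≈ ∑ (𝓔 D) summand
      det-expansion = begin
        det M
          ≈⟨ leibniz M ⟩
        ∑ (codes n) (λ κ → sgn κ * ∏ (allFin n) (λ v → M v (decode κ v)))
          ≈⟨ Sum.fold-cong (codes n) (λ {κ} _ → term κ (follows? κ)) ⟩
        ∑ (codes n) (Sum.restrict follows? term′)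
          ≈⟨ Sum.fold-filter follows? (codes n) ⟨
        ∑ (filter follows? (codes n)) term′
          ≈⟨ reflexive (Sum.fold-map (supportDigraph ∘ decode) (filter follows? (codes n))) ⟨
        ∑ (elementarySupports D) summand
          ≈⟨ Sum.fold-↭ (elementarySupports↭𝓔 D) ⟩
        ∑ (𝓔 D) summand ∎
        where
        follows? = followsArcs? D ∘ decode

        term′ : Code n → Carrier
        term′ = summand ∘ supportDigraph ∘ decode

        term : ∀ κ → Dec (FollowsArcs D (decode κ)) →
          sgn κ * ∏ (allFin n) (λ v → M v (decode κ v)) ≈
          Sum.restrict follows? term′ κ
        term κ (yes follows) = ≈-trans (term-support κ) (≈-sym (Sum.restrict-∈ follows? term′ κ follows))
        term κ (no ¬follows) =
          ≈-trans (≈-trans (*-congˡ (term-vanishes ¬follows)) (zeroʳ _))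
            (≈-sym (Sum.restrict-∉ follows? term′ κ ¬follows))

    private
      A-diagonal : ∀ u → A u u ≈ 0#
      A-diagonal u = A-support (Digraph.loopless D u)

    det-diag⊟ : det (diag d ⊟ A) ≈
      ∑ (𝓔 D) (λ H → -1^ (Subdigraph.c H) * gain A H * ∏ (uncovered H) d)
    det-diag⊟ = ≈-trans (det-expansion (- 1#) (diag d ⊟ A) diagonal arc)
      (Sum.fold-cong (𝓔 D) (λ {H} _ → simplify H))
      where
      diagonal : ∀ u → (diag d ⊟ A) u u ≈ d u
      diagonal u with u ≟ u
      ... | yes _ = ≈-trans (+-congˡ (≈-trans (-‿cong (A-diagonal u)) -0#≈0#)) (+-identityʳ (d u))
      ... | no ¬p = contradiction refl ¬p

      arc : ∀ {u v} → u ≢ v → (diag d ⊟ A) u v ≈ - 1# * A u v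
      arc {u} {v} u≢v with u ≟ v
      ... | yes p = contradiction p u≢v
      ... | no  _ = ≈-trans (+-identityˡ _) (≈-sym (-1*x≈-x _))

      simplify : ∀ H →
        -1^ ∣ Subdigraph.V H ∣ *
          (-1^ (∣ Subdigraph.V H ∣ + Subdigraph.c H) * gain A H * ∏ (uncovered H) d) ≈
        -1^ (Subdigraph.c H) * gain A H * ∏ (uncovered H) d
      simplify H = ≈-trans (≈-sym (*-assoc _ _ _)) (*-congʳ (≈-trans (≈-sym (*-assoc _ _ _)) (*-congʳ (begin
        -1^ v * -1^ (v + k)        ≈⟨ *-congˡ (^-homo-* (- 1#) v k) ⟩
        -1^ v * (-1^ v * -1^ k)    ≈⟨ *-assoc _ _ _ ⟨
        -1^ v * -1^ v * -1^ k      ≈⟨ *-congʳ (-1^k*-1^k v) ⟩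
        1# * -1^ k                 ≈⟨ *-identityˡ _ ⟩
        -1^ k                      ∎))))
        where
        v = ∣ Subdigraph.V H ∣
        k = Subdigraph.c H

    det-diag⊞ : det (diag d ⊞ A) ≈
      ∑ (𝓔 D) (λ H → -1^ (∣ Subdigraph.V H ∣ + Subdigraph.c H) * gain A H * ∏ (uncovered H) d)
    det-diag⊞ = ≈-trans (det-expansion 1# (diag d ⊞ A) diagonal arc)
      (Sum.fold-cong (𝓔 D) (λ {H} _ → ≈-trans (*-congʳ (1^k ∣ Subdigraph.V H ∣)) (*-identityˡ _)))
      where
      diagonal : ∀ u → (diag d ⊞ A) u u ≈ d u
      diagonal u with u ≟ u
      ... | yes _ = ≈-trans (+-congˡ (A-diagonal u)) (+-identityʳ (d u))
      ... | no ¬p = contradiction refl ¬p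

      arc : ∀ {u v} → u ≢ v → (diag d ⊞ A) u v ≈ 1# * A u v
      arc {u} {v} u≢v with u ≟ v
      ... | yes p = contradiction p u≢v
      ... | no  _ = ≈-trans (+-identityˡ _) (≈-sym (*-identityˡ _))

      1^k : ∀ k → 1# ^ k ≈ 1#
      1^k zero    = ≈-refl
      1^k (suc k) = ≈-trans (*-identityˡ _) (1^k k)

-- Specialisation to complex gain digraphs

open Defs using (det; ∑; ∏; V; c)
open Expansion ℂ.commutativeRing using (walkProduct; gain; det-diag⊟; det-diag⊞)

private module ℂʳ = CommutativeRing ℂ.commutativeRing
open 𝕋GainDigraph using (A; walkGain; arcs)

walkGain≡walkProduct : ∀ {n} (Φ : 𝕋GainDigraph n) us → walkGain Φ us ≡ walkProduct (A Φ) us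
walkGain≡walkProduct Φ []           = refl
walkGain≡walkProduct Φ (_ ∷ [])     = refl
walkGain≡walkProduct Φ (u ∷ v ∷ us) = cong (A Φ u v *ᶜ_) (walkGain≡walkProduct Φ (v ∷ us))

A-support : ∀ {n} (Φ : 𝕋GainDigraph n) {u v} → ¬ (u ⟶[ arcs Φ ] v) → A Φ u v ≈ᶜ 0ᶜ
A-support Φ {u} {v} ¬uv with u ⟶[ arcs Φ ]? v
... | yes uv = contradiction uv ¬uv
... | no  _  = ℂʳ.refl

φᴱ≈gain : ∀ {n} (Φ : 𝕋GainDigraph n) H → φᴱ Φ H ≈ᶜ gain (A Φ) H
φᴱ≈gain Φ H = FoldProperties.fold-cong ℂʳ.*-commutativeMonoid (directedCycles (Subdigraph.arcs H))
  (λ {C} _ → ℂʳ.reflexive (walkGain≡walkProduct Φ (Cycle.closedWalk C)))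

theorem5p1 : ∀ {n : ℕ} (Φ : 𝕋GainDigraph n) →
    (det (L Φ) ≈ᶜ
    (∑[ E ← 𝓔 (digraph Φ) ]
    ((-ᶜ 1ᶜ) ^ᶜ c E *ᶜ φᴱ Φ E *ᶜ (∏[ v ← uncovered E ] deg⁺ᶜ Φ v))))
    ×
    (det (Q Φ) ≈ᶜ
    (∑[ E ← 𝓔 (digraph Φ) ]
    ((-ᶜ 1ᶜ) ^ᶜ (∣ V E ∣ + c E) *ᶜ φᴱ Φ E *ᶜ (∏[ v ← uncovered E ] deg⁺ᶜ Φ v))))
theorem5p1 Φ =
    ℂʳ.trans (det-diag⊟ (digraph Φ) (A Φ) (deg⁺ᶜ Φ) (A-support Φ)) (∑-cong λ H → ℂʳ.*-congʳ (gains H))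
  , ℂʳ.trans (det-diag⊞ (digraph Φ) (A Φ) (deg⁺ᶜ Φ) (A-support Φ)) (∑-cong λ H → ℂʳ.*-congʳ (gains H))
  where
  gains : ∀ {z} H → z *ᶜ gain (A Φ) H ≈ᶜ z *ᶜ φᴱ Φ H
  gains H = ℂʳ.*-congˡ (ℂʳ.sym (φᴱ≈gain Φ H))

  ∑-cong : ∀ {f g} → (∀ H → f H ≈ᶜ g H) → ∑ (𝓔 (digraph Φ)) f ≈ᶜ ∑ (𝓔 (digraph Φ)) g
  ∑-cong eq = FoldProperties.fold-cong ℂʳ.+-commutativeMonoid (𝓔 (digraph Φ)) (λ {H} _ → eq H)
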